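{- Let $H$ be a bipartite graph with bipartition $X\cup Y$ such that every vertex of $Y$ has degree at most $2$, and suppose $H$ contains no copy of $C_4$. Then there exist positive constants $C$ and $\delta$ such that for all $n$, \[\mathrm{ex}(n,H) \leq C n^{3/2 - \delta}.\]
   Context: For a graph $H$ and a natural number $n$, the extremal number $\mathrm{ex}(n,H)$ is the largest number of edges in an $n$-vertex graph containing no copy of $H$ (as a subgraph). "Maximum degree two on one side" means that all vertices in one of the two parts of the bipartition have degree at most $2$. -}

module Defs where

open import Data.Nat using (ℕ; zero; suc; _+_; _<ᵇ_; _≡ᵇ_; _%_)
open import Data.Bool using (Bool; true; false; _∧_; _∨_; if_then_else_)
open import Data.Bool.Properties using (∨-comm)
open import Data.Fin using (Fin; zero; suc; toℕ)
open import Data.Product using (Σ; _×_)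
open import Function.Definitions using (Injective)
open import Relation.Binary.PropositionalEquality using (_≡_; refl)

record Graph (n : ℕ) : Set where
  field
    adj    : Fin n → Fin n → Bool
    sym    : ∀ i j → adj i j ≡ adj j i
    irrefl : ∀ i → adj i i ≡ false
open Graph public

sumFin : ∀ {n} → (Fin n → ℕ) → ℕ
sumFin {zero}  f = 0
sumFin {suc n} f = f zero + sumFin (λ i → f (suc i))

edges : ∀ {n} → Graph n → ℕ
edges G = sumFin λ i → sumFin λ j →
  if adj G i j ∧ (toℕ i <ᵇ toℕ j) then 1 else 0

degree : ∀ {n} → Graph n → Fin n → ℕ
degree G v = sumFin λ j → if adj G v j then 1 else 0

Contains : ∀ {n k} → Graph n → Graph k → Set
Contains {n} {k} G H =
  Σ (Fin k → Fin n) λ f →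
    Injective _≡_ _≡_ f × (∀ i j → adj H i j ≡ true → adj G (f i) (f j) ≡ true)

-- c is a proper 2-colouring: every edge joins the two classes
-- (X = vertices coloured true, Y = vertices coloured false).
IsBipartition : ∀ {k} → Graph k → (Fin k → Bool) → Set
IsBipartition {k} H c = ∀ i j → adj H i j ≡ true → (c i ≡ true × c j ≡ false) Data.Sum.⊎ (c i ≡ false × c j ≡ true)
  where import Data.Sum

c4step : Fin 4 → Fin 4 → Bool
c4step i j = (suc (toℕ i) % 4) ≡ᵇ toℕ j

C4 : Graph 4
C4 = record
  { adj = λ i j → c4step i j ∨ c4step j i
  ; sym = λ i j → ∨-comm (c4step i j) (c4step j i)
  ; irrefl = irr
  }
  where
  irr : ∀ i → (c4step i i ∨ c4step i i) ≡ false
  irr zero = refl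
  irr (suc zero) = refl
  irr (suc (suc zero)) = refl
  irr (suc (suc (suc zero))) = refl

{-# OPTIONS --safe #-}
-- Janzer's argument.  Since H has no C₄, its vertices of Y correspond to distinct pairs of vertices of X
-- (after adding dummies), so H lies in the 1-subdivision of a complete graph on t "slots".  Induct on
-- subsets S of the host graph.  If few high-degree vertices meet half of the edges, a much smaller and
-- relatively denser subset contradicts the induction hypothesis.  Otherwise there are a set L with degrees
-- at most Dδ and a linear-sized A ⊆ L of vertices of degree at least δ.  Call a pair heavy if it has at
-- least T common neighbours and light if it has between 1 and T.  A heavy clique on t vertices extends
-- greedily to the subdivision; without one, Turán inside the neighbourhoods shows that a δ²/N fraction of
-- the pairs in any large U ⊆ A is light.  Hence slots can be chosen one at a time, each light to all
-- previous ones, while discarding only O(δ) candidates to keep the links of different pairs disjoint.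

module Submission where

open import Defs
open import Data.Nat using (ℕ; zero; suc; _+_; _*_; _^_; _≤_; _<_; _≤ᵇ_; z≤n; s≤s; NonZero; _/_; _%_; >-nonZero; >-nonZero⁻¹)
open import Data.Nat.Properties
open import Data.Nat.DivMod using (m≡m%n+[m/n]*n; m%n<n; m/n*n≤m)
open import Data.Nat.Tactic.RingSolver using (solve-∀)
open import Data.Bool using (Bool; true; false; _∧_; _∨_; not; if_then_else_)
open import Data.Bool.Properties using (T-≡)
open import Data.Fin using (Fin; zero; suc; combine) renaming (_<_ to _<ᶠ_)
import Data.Bool as B
import Data.Fin.Properties as F
open import Data.List using (List; []; _∷_; length; filter; tabulate; allFin)
open import Data.List.Properties using (length-tabulate)
open import Data.List.Membership.Propositional using (_∈_; _∉_)
open import Data.List.Membership.Propositional.Properties using (∈-filter⁺; ∈-filter⁻; ∈-allFin; ∈-tabulate⁺)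
open import Data.List.Relation.Unary.Any using (here; there)
open import Data.List.Relation.Unary.All using () renaming (_∷_ to _∷ᵃ_)
open import Data.List.Relation.Unary.AllPairs using () renaming (_∷_ to _∷ᵖ_)
open import Data.List.Relation.Unary.Unique.Propositional using (Unique)
import Data.List.Relation.Unary.Unique.Propositional.Properties as Uniq
open import Data.Product using (Σ; ∃; _×_; _,_; proj₁; proj₂)
open import Data.Sum using (_⊎_; inj₁; inj₂)
open import Data.Empty using (⊥-elim)
open import Function using (_∘_; const; id; it)
open import Function.Bundles using (Equivalence)
open import Function.Definitions using (Injective)
open import Relation.Nullary using (¬_; yes; no; does; contradiction)
open import Relation.Binary using (tri<; tri≈; tri>)
open import Relation.Binary.PropositionalEquality using (_≡_; _≢_; refl; trans; cong; cong₂; subst) renaming (sym to ≡-sym)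

-- The saving in the exponent comes from the cost of the greedy choice. Every new slot may divide
-- the candidate set by about `N / δ²`, and a step is possible while `δ |U|` exceeds a constant
-- times `N`. Starting from linearly many candidates, it therefore suffices that `δ (δ² / N)^i` is
-- large for all `i ≤ t`. With `δ` of order `e / N`, where `e` counts edges, this reads
-- `e^(2i+1) ≥ c N^(3i+1)`, and `(3i+1)/(2i+1) = 3/2 - 1/(4i+2)` lies below `3/2`. The exponent
-- `3/2 - 1/(4t+3)` meets all these demands. The obstacle is irregularity: each common neighbour of
-- two chosen slots rules out all of its own neighbours as later slots, so degrees must not exceed
-- the order of `δ`. A host graph need not have this property, which is why the bound is proved for
-- all subsets of its vertices at once, with one constant. Writing it as `e ^ m ≤ C * N ^ r` in
-- natural numbers avoids fractional exponents and division.

private variable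
  n k : ℕ

-- Boolean subsets of a finite set and sums over them

∧-true⁻ : ∀ {a b} → a ∧ b ≡ true → a ≡ true × b ≡ true
∧-true⁻ {true} {true} _ = refl , refl

∧-true⁺ : ∀ {a b} → a ≡ true → b ≡ true → a ∧ b ≡ true
∧-true⁺ refl refl = refl

not-true⁻ : ∀ {a} → not a ≡ true → a ≡ false
not-true⁻ {false} _ = refl

true≢false : ∀ {b} → b ≡ true → b ≢ false
true≢false refl ()

≤ᵇ-true⁻ : ∀ {a b} → (a ≤ᵇ b) ≡ true → a ≤ b
≤ᵇ-true⁻ {a} {b} eq = ≤ᵇ⇒≤ a b (Equivalence.from T-≡ eq)

≤ᵇ-true⁺ : ∀ {a b} → a ≤ b → (a ≤ᵇ b) ≡ true
≤ᵇ-true⁺ a≤b = Equivalence.to T-≡ (≤⇒≤ᵇ a≤b)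

≤ᵇ-false⁻ : ∀ {a b} → (a ≤ᵇ b) ≡ false → b < a
≤ᵇ-false⁻ eq = ≰⇒> λ a≤b → true≢false (≤ᵇ-true⁺ a≤b) eq

Subset : ℕ → Set
Subset n = Fin n → Bool

𝟙 : Bool → ℕ
𝟙 b = if b then 1 else 0

infix 4 _⊑_
_⊑_ : Subset n → Subset n → Set
S ⊑ R = ∀ v → S v ≡ true → R v ≡ true

_⩕_ : Subset n → Subset n → Subset n
(S ⩕ R) v = S v ∧ R v

_∖_ : Subset n → Subset n → Subset n
(S ∖ R) v = S v ∧ not (R v)

_⩖_ : Subset n → Subset n → Subset n
(S ⩖ R) v = S v ∨ R v

sumOn : Subset n → (Fin n → ℕ) → ℕ
sumOn S f = sumFin λ v → if S v then f v else 0

card : Subset n → ℕ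
card S = sumOn S (const 1)

⩕-⊑ˡ : (S R : Subset n) → S ⩕ R ⊑ S
⩕-⊑ˡ S R v = proj₁ ∘ ∧-true⁻

∖-⊑ : (S R : Subset n) → S ∖ R ⊑ S
∖-⊑ S R v = proj₁ ∘ ∧-true⁻

⩖-⊑ˡ : (S R : Subset n) → S ⊑ S ⩖ R
⩖-⊑ˡ S R v eq rewrite eq = refl

⩖-⊑ʳ : (S R : Subset n) → R ⊑ S ⩖ R
⩖-⊑ʳ S R v eq with S v
... | true  = refl
... | false = eq

sumFin-mono : {f g : Fin n → ℕ} → (∀ v → f v ≤ g v) → sumFin f ≤ sumFin g
sumFin-mono {zero}  le = z≤n
sumFin-mono {suc n} le = +-mono-≤ (le zero) (sumFin-mono (le ∘ suc))

sumFin-cong : {f g : Fin n → ℕ} → (∀ v → f v ≡ g v) → sumFin f ≡ sumFin g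
sumFin-cong {zero}  eq = refl
sumFin-cong {suc n} eq = cong₂ _+_ (eq zero) (sumFin-cong (eq ∘ suc))

sumFin-0 : sumFin {n} (const 0) ≡ 0
sumFin-0 {zero}  = refl
sumFin-0 {suc n} = sumFin-0 {n}

sumFin-1 : sumFin {n} (const 1) ≡ n
sumFin-1 {zero}  = refl
sumFin-1 {suc n} = cong suc sumFin-1

+-interchange : ∀ a b c d → (a + b) + (c + d) ≡ (a + c) + (b + d)
+-interchange = solve-∀

sumFin-+ : (f g : Fin n → ℕ) → sumFin (λ v → f v + g v) ≡ sumFin f + sumFin g
sumFin-+ {zero}  f g = refl
sumFin-+ {suc n} f g = trans (cong (f zero + g zero +_) (sumFin-+ (f ∘ suc) (g ∘ suc)))
  (+-interchange (f zero) (g zero) (sumFin (f ∘ suc)) (sumFin (g ∘ suc)))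

sumFin-* : (c : ℕ) (f : Fin n → ℕ) → sumFin (λ v → c * f v) ≡ c * sumFin f
sumFin-* {zero}  c f = ≡-sym (*-zeroʳ c)
sumFin-* {suc n} c f = trans (cong (c * f zero +_) (sumFin-* c (f ∘ suc)))
  (≡-sym (*-distribˡ-+ c (f zero) (sumFin (f ∘ suc))))

sumFin-swap : ∀ {m} (f : Fin n → Fin m → ℕ) →
  sumFin (λ u → sumFin (f u)) ≡ sumFin (λ v → sumFin (λ u → f u v))
sumFin-swap {zero}  {m} f = ≡-sym (sumFin-0 {m})
sumFin-swap {suc n} f = trans (cong (sumFin (f zero) +_) (sumFin-swap (f ∘ suc)))
  (≡-sym (sumFin-+ (f zero) (λ v → sumFin (λ u → f (suc u) v))))

sumOn-mono : (S : Subset n) {f g : Fin n → ℕ} → (∀ v → S v ≡ true → f v ≤ g v) → sumOn S f ≤ sumOn S g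
sumOn-mono S {f} {g} le = sumFin-mono pointwise
  where
  pointwise : ∀ v → (if S v then f v else 0) ≤ (if S v then g v else 0)
  pointwise v with S v in eq
  ... | true  = le v eq
  ... | false = z≤n

sumOn-cong : (S : Subset n) {f g : Fin n → ℕ} → (∀ v → f v ≡ g v) → sumOn S f ≡ sumOn S g
sumOn-cong S eq = sumFin-cong λ v → cong (if S v then_else 0) (eq v)

sumOn-⊑ : {S R : Subset n} {f : Fin n → ℕ} → S ⊑ R → sumOn S f ≤ sumOn R f
sumOn-⊑ {S = S} {R} {f} sub = sumFin-mono pointwise
  where
  pointwise : ∀ v → (if S v then f v else 0) ≤ (if R v then f v else 0)
  pointwise v with S v in eq
  ... | false = z≤n
  ... | true rewrite sub v eq = ≤-refl

sumOn-+ : (S : Subset n) (f g : Fin n → ℕ) → sumOn S (λ v → f v + g v) ≡ sumOn S f + sumOn S g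
sumOn-+ {n} S f g = trans (sumFin-cong pointwise) (sumFin-+ {n} _ _)
  where
  pointwise : ∀ v → (if S v then f v + g v else 0) ≡ (if S v then f v else 0) + (if S v then g v else 0)
  pointwise v with S v
  ... | true  = refl
  ... | false = refl

sumOn-* : (S : Subset n) (c : ℕ) (f : Fin n → ℕ) → sumOn S (λ v → c * f v) ≡ c * sumOn S f
sumOn-* {n} S c f = trans (sumFin-cong pointwise) (sumFin-* {n} c _)
  where
  pointwise : ∀ v → (if S v then c * f v else 0) ≡ c * (if S v then f v else 0)
  pointwise v with S v
  ... | true  = refl
  ... | false = ≡-sym (*-zeroʳ c)

sumOn-*ʳ : (S : Subset n) (c : ℕ) (f : Fin n → ℕ) → sumOn S (λ v → f v * c) ≡ sumOn S f * c
sumOn-*ʳ S c f = trans (sumOn-cong S λ v → *-comm (f v) c) (trans (sumOn-* S c f) (*-comm c _))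

sumOn-const : (S : Subset n) (c : ℕ) → sumOn S (const c) ≡ card S * c
sumOn-const S c = trans (sumOn-cong S λ _ → ≡-sym (*-identityˡ c)) (sumOn-*ʳ S c (const 1))

sumOn-swap : ∀ {m} (S : Subset n) (R : Subset m) (f : Fin n → Fin m → ℕ) →
  sumOn S (λ u → sumOn R (f u)) ≡ sumOn R (λ v → sumOn S (λ u → f u v))
sumOn-swap {n} {m} S R f = trans (sumFin-cong left) (trans (sumFin-swap {n} {m} _) (sumFin-cong right))
  where
  left : ∀ u → (if S u then sumOn R (f u) else 0) ≡
    sumFin (λ v → if S u then (if R v then f u v else 0) else 0)
  left u with S u
  ... | true  = refl
  ... | false = ≡-sym (sumFin-0 {m})
  right : ∀ v → sumFin (λ u → if S u then (if R v then f u v else 0) else 0) ≡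
    (if R v then sumOn S (λ u → f u v) else 0)
  right v with R v
  ... | true  = refl
  ... | false = trans (sumFin-cong zeros) (sumFin-0 {n})
    where
    zeros : ∀ u → (if S u then 0 else 0) ≡ 0
    zeros u with S u
    ... | true  = refl
    ... | false = refl

sumOn-⩕ : (S P : Subset n) (f : Fin n → ℕ) → sumOn (S ⩕ P) f ≡ sumOn S (λ v → 𝟙 (P v) * f v)
sumOn-⩕ S P f = sumFin-cong pointwise
  where
  pointwise : ∀ v → (if S v ∧ P v then f v else 0) ≡ (if S v then 𝟙 (P v) * f v else 0)
  pointwise v with S v | P v
  ... | true  | true  = ≡-sym (+-identityʳ (f v))
  ... | true  | false = refl
  ... | false | _     = refl

card-⩕ : (S P : Subset n) → card (S ⩕ P) ≡ sumOn S (λ v → 𝟙 (P v))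
card-⩕ S P = trans (sumOn-⩕ S P (const 1)) (sumOn-cong S λ v → *-identityʳ (𝟙 (P v)))

sumOn-split : (S P : Subset n) (f : Fin n → ℕ) → sumOn S f ≡ sumOn (S ⩕ P) f + sumOn (S ∖ P) f
sumOn-split {n} S P f = trans (sumFin-cong pointwise) (sumFin-+ {n} _ _)
  where
  pointwise : ∀ v → (if S v then f v else 0) ≡
    (if S v ∧ P v then f v else 0) + (if S v ∧ not (P v) then f v else 0)
  pointwise v with S v | P v
  ... | true  | true  = ≡-sym (+-identityʳ (f v))
  ... | true  | false = refl
  ... | false | _     = refl

card-⩖ : (S R : Subset n) → card (S ⩖ R) ≤ card S + card R
card-⩖ {n} S R = ≤-trans (sumFin-mono pointwise) (≤-reflexive (sumFin-+ {n} _ _))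
  where
  pointwise : ∀ v → 𝟙 (S v ∨ R v) ≤ 𝟙 (S v) + 𝟙 (R v)
  pointwise v with S v
  ... | true  = s≤s z≤n
  ... | false = ≤-refl

-- Averaging and Cauchy-Schwarz

card>0⇒∃ : (S : Subset n) → 0 < card S → ∃ λ v → S v ≡ true
card>0⇒∃ {suc n} S pos with S zero in eq
... | true  = zero , eq
... | false with v , Sv ← card>0⇒∃ (S ∘ suc) pos = suc v , Sv

sumOn-term : (S : Subset n) (f : Fin n → ℕ) (v : Fin n) → S v ≡ true → f v ≤ sumOn S f
sumOn-term {suc n} S f zero    Sv rewrite Sv = m≤m+n (f zero) _
sumOn-term {suc n} S f (suc v) Sv = ≤-trans (sumOn-term (S ∘ suc) (f ∘ suc) v Sv) (m≤n+m _ _)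

-- The set where `f v ≤ g v` is decidable: either its cardinality yields a witness, or `f` exceeds
-- `g` by at least 1 on all of the nonempty `S`, against the comparison of sums.
average : (S : Subset n) (f g : Fin n → ℕ) → 0 < card S → sumOn S f ≤ sumOn S g →
  ∃ λ v → S v ≡ true × f v ≤ g v
average S f g pos le with card (S ⩕ λ v → f v ≤ᵇ g v) in eq
... | suc _ with v , Sv ← card>0⇒∃ (S ⩕ λ v → f v ≤ᵇ g v) (subst (0 <_) (≡-sym eq) (s≤s z≤n)) =
  v , proj₁ (∧-true⁻ Sv) , ≤ᵇ-true⁻ (proj₂ (∧-true⁻ {S v} Sv))
... | zero = contradiction (≤-trans (sumOn-mono S small) le)
                           (<⇒≱ (subst (sumOn S g <_) (≡-sym (sumOn-+ S (const 1) g)) (+-monoˡ-≤ (sumOn S g) pos)))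
  where
  small : ∀ v → S v ≡ true → suc (g v) ≤ f v
  small v Sv with f v ≤ᵇ g v in e
  ... | false = ≤ᵇ-false⁻ e
  ... | true  = contradiction
    (subst (1 ≤_) eq (sumOn-term (S ⩕ λ v → f v ≤ᵇ g v) (const 1) v (∧-true⁺ Sv e))) λ ()

2xy≤x²+y² : ∀ x y → 2 * (x * y) ≤ x * x + y * y
2xy≤x²+y² x y with ≤-total x y
... | inj₁ x≤y with d , refl ← m≤n⇒∃[o]m+o≡n x≤y = ≤-trans (m≤m+n _ (d * d)) (≤-reflexive (identity x d))
  where
  identity : ∀ x d → 2 * (x * (x + d)) + d * d ≡ x * x + (x + d) * (x + d)
  identity = solve-∀
... | inj₂ y≤x with d , refl ← m≤n⇒∃[o]m+o≡n y≤x = ≤-trans (m≤m+n _ (d * d)) (≤-reflexive (identity y d))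
  where
  identity : ∀ y d → 2 * ((y + d) * y) + d * d ≡ (y + d) * (y + d) + y * y
  identity = solve-∀

-- Summing `2xy ≤ x² + y²` over all pairs from `S` avoids any subtraction.
cauchy-schwarz : (S : Subset n) (f : Fin n → ℕ) → sumOn S f * sumOn S f ≤ card S * sumOn S (λ v → f v * f v)
cauchy-schwarz S f = *-cancelˡ-≤ 2 (begin
  2 * (sumOn S f * sumOn S f)                                   ≡⟨ cong (2 *_) (sumOn-*ʳ S _ f) ⟨
  2 * sumOn S (λ u → f u * sumOn S f)                           ≡⟨ cong (2 *_) (sumOn-cong S λ u → ≡-sym (sumOn-* S (f u) f)) ⟩
  2 * sumOn S (λ u → sumOn S (λ v → f u * f v))                 ≡⟨ sumOn-* S 2 _ ⟨
  sumOn S (λ u → 2 * sumOn S (λ v → f u * f v))                 ≡⟨ sumOn-cong S (λ u → ≡-sym (sumOn-* S 2 _)) ⟩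
  sumOn S (λ u → sumOn S (λ v → 2 * (f u * f v)))               ≤⟨ sumOn-mono S (λ u _ → sumOn-mono S (λ v _ → 2xy≤x²+y² (f u) (f v))) ⟩
  sumOn S (λ u → sumOn S (λ v → f u * f u + f v * f v))         ≡⟨ sumOn-cong S (λ u → sumOn-+ S _ _) ⟩
  sumOn S (λ u → sumOn S (λ _ → f u * f u) + Q)                 ≡⟨ sumOn-+ S _ _ ⟩
  sumOn S (λ u → sumOn S (λ _ → f u * f u)) + sumOn S (λ _ → Q) ≡⟨ cong₂ _+_ (trans (sumOn-cong S λ u → sumOn-const S _) (sumOn-* S (card S) _)) (sumOn-const S Q) ⟩
  card S * Q + card S * Q                                       ≡⟨ double (card S * Q) ⟩
  2 * (card S * Q)                                              ∎)
  where
  open ≤-Reasoning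
  Q = sumOn S (λ v → f v * f v)
  double : ∀ x → x + x ≡ 2 * x
  double = solve-∀

-- Greedy selections: representatives, heavy parts, cliques

_==_ : Fin n → Fin n → Bool
u == v = does (u F.≟ v)

==-false⁻ : {u v : Fin n} → (u == v) ≡ false → u ≢ v
==-false⁻ {u = u} {v} eq with no p ← u F.≟ v = p

card-== : (u : Fin n) → card (u ==_) ≡ 1
card-== {suc n} zero    = cong suc (sumFin-0 {n})
card-== {suc n} (suc u) = card-== u

card-⩕-== : (S : Subset n) (u : Fin n) → card (S ⩕ (u ==_)) ≤ 1
card-⩕-== S u = ≤-trans (sumOn-⊑ {f = const 1} λ v → proj₂ ∘ ∧-true⁻ {S v}) (≤-reflexive (card-== u))

card-∖-== : (S : Subset n) (u : Fin n) → card S ≤ suc (card (S ∖ (u ==_)))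
card-∖-== S u = ≤-trans (≤-reflexive (sumOn-split S (u ==_) (const 1))) (+-monoˡ-≤ _ (card-⩕-== S u))

pick-outside : (S : Subset n) (xs : List (Fin n)) → length xs < card S → ∃ λ v → S v ≡ true × v ∉ xs
pick-outside S []       lt with v , Sv ← card>0⇒∃ S lt = v , Sv , λ ()
pick-outside S (x ∷ xs) lt
  with v , Sv , v∉xs ← pick-outside (S ∖ (x ==_)) xs (+-cancelˡ-≤ 1 _ _ (≤-trans lt (card-∖-== S x))) =
  v , proj₁ (∧-true⁻ Sv) , λ
    { (here v≡x)   → ==-false⁻ (not-true⁻ (proj₂ (∧-true⁻ {S v} Sv))) (≡-sym v≡x)
    ; (there v∈xs) → v∉xs v∈xs }

-- The sets are so large that no Hall condition is needed: forbidden elements and earlier choices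
-- together cannot exhaust any of them. The list `xs` absorbs each choice in the recursion; in the
-- application it starts as the list of slots, which keeps the links away from them.
distinct-representatives : (F : Fin k → Subset n) (xs : List (Fin n)) → (∀ y → length xs + k ≤ card (F y)) →
  Σ (Fin k → Fin n) λ f → (∀ y → F y (f y) ≡ true) × (∀ y → f y ∉ xs) × Injective _≡_ _≡_ f
distinct-representatives {k = zero} F xs large = (λ ()) , (λ ()) , (λ ()) , λ {}
distinct-representatives {k = suc k} F xs large
  with v , Fv , v∉xs ← pick-outside (F zero) xs (≤-trans (≤-trans (s≤s (m≤m+n _ k)) (≤-reflexive (≡-sym (+-suc _ k)))) (large zero))
  with f , Ff , f∉ , inj ← distinct-representatives (F ∘ suc) (v ∷ xs) (λ y → ≤-trans (≤-reflexive (≡-sym (+-suc _ k))) (large (suc y)))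
  = g , Fg , g∉ , g-inj
  where
  g : Fin (suc k) → Fin _
  g zero    = v
  g (suc y) = f y
  Fg : ∀ y → F y (g y) ≡ true
  Fg zero    = Fv
  Fg (suc y) = Ff y
  g∉ : ∀ y → g y ∉ xs
  g∉ zero    = v∉xs
  g∉ (suc y) = f∉ y ∘ there
  g-inj : Injective _≡_ _≡_ g
  g-inj {zero}  {zero}  _  = refl
  g-inj {zero}  {suc y} eq = contradiction (here (≡-sym eq)) (f∉ y)
  g-inj {suc x} {zero}  eq = contradiction (here eq) (f∉ x)
  g-inj {suc x} {suc y} eq = cong suc (inj eq)

take-subset : (S : Subset n) (m : ℕ) → m ≤ card S → ∃ λ R → R ⊑ S × card R ≡ m
take-subset {n} S zero le = const false , (λ _ ()) , sumFin-0 {n}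
take-subset {suc n} S (suc m) le with S zero in eq
take-subset {suc n} S (suc m) (s≤s le) | true with R , R⊑S , cardR ← take-subset (S ∘ suc) m le =
  R′ , R′⊑S , cong suc cardR
  where
  R′ : Subset (suc n)
  R′ zero    = true
  R′ (suc v) = R v
  R′⊑S : R′ ⊑ S
  R′⊑S zero    _ = eq
  R′⊑S (suc v) = R⊑S v
take-subset {suc n} S (suc m) le | false with R , R⊑S , cardR ← take-subset (S ∘ suc) (suc m) le =
  R′ , R′⊑S , cardR
  where
  R′ : Subset (suc n)
  R′ zero    = false
  R′ (suc v) = R v
  R′⊑S : R′ ⊑ S
  R′⊑S zero    ()
  R′⊑S (suc v) = R⊑S v

-- Pigeonhole over a partition into `P` parts of size at most `m`: peel off `m` elements and keep
-- the heavier of this part and the best one among the rest. For `P = 0` the set is empty and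
-- carries no weight.
heavy-part : (S : Subset n) (w : Fin n → ℕ) (P m : ℕ) → card S ≤ P * m →
  ∃ λ R → card R ≤ m × sumOn S w ≤ P * sumOn R w
heavy-part {n} S w zero m le = const false , ≤-trans (≤-reflexive (sumFin-0 {n})) z≤n ,
  ≮⇒≥ λ pos → contradiction (≤-trans (nonempty S pos) le) λ ()
  where
  nonempty : ∀ {n} (S : Subset n) {w : Fin n → ℕ} → 0 < sumOn S w → 0 < card S
  nonempty {suc n} S pos with S zero
  ... | true  = s≤s z≤n
  ... | false = nonempty (S ∘ suc) pos
heavy-part S w (suc P) m le with ≤-total (card S) m
... | inj₁ small = S , small , m≤m+n _ _
... | inj₂ large with R₁ , R₁⊑S , cardR₁ ← take-subset S m large
  with R₂ , cardR₂ , heavy ← heavy-part (S ∖ R₁) w P m (+-cancelˡ-≤ m _ _ (≤-trans (≤-reflexive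
         (trans (cong (_+ card (S ∖ R₁)) (trans (≡-sym cardR₁) (≤-antisym (sumOn-⊑ λ v R₁v → ∧-true⁺ (R₁⊑S v R₁v) R₁v)
           (sumOn-⊑ λ v → proj₂ ∘ ∧-true⁻ {S v})))) (≡-sym (sumOn-split S R₁ (const 1))))) le))
  with ≤-total (sumOn R₁ w) (sumOn R₂ w)
...   | inj₁ R₁≤R₂ = R₂ , cardR₂ , ≤-trans (≤-reflexive (sumOn-split S R₁ w))
          (+-mono-≤ (≤-trans (sumOn-⊑ λ v → proj₂ ∘ ∧-true⁻ {S v}) R₁≤R₂) heavy)
...   | inj₂ R₂≤R₁ = R₁ , ≤-reflexive cardR₁ , ≤-trans (≤-reflexive (sumOn-split S R₁ w))
          (+-mono-≤ (sumOn-⊑ λ v → proj₂ ∘ ∧-true⁻ {S v}) (≤-trans heavy (*-monoʳ-≤ P R₂≤R₁)))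

-- Each pick deletes at most `m / c` elements, so a set of size `j * m / c` allows `j` picks. Bad
-- partners are counted in the fixed set `S`, so that the estimate stays valid while `R` shrinks.
greedy-clique : (bad : Fin n → Fin n → Bool) (S : Subset n) (c m : ℕ) → 0 < m →
  (j : ℕ) (R : Subset n) → R ⊑ S → (∀ u → R u ≡ true → c * card (S ⩕ bad u) ≤ m) → j * m ≤ c * card R →
  Σ (Fin j → Fin n) λ x → (∀ i → R (x i) ≡ true) × (∀ i i′ → i <ᶠ i′ → bad (x i) (x i′) ≡ false)
greedy-clique bad S c m m>0 zero R R⊑S few large = (λ ()) , (λ ()) , λ ()
greedy-clique {n} bad S c m m>0 (suc j) R R⊑S few large
  with u , Ru ← card>0⇒∃ R (*-cancelˡ-< c 0 (card R) (≤-trans (s≤s (≤-reflexive (*-zeroʳ c))) (≤-trans m>0 (m+n≤o⇒m≤o m large))))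
  with x , Rx , good ← greedy-clique bad S c m m>0 j (R ∖ bad u) (λ v → R⊑S v ∘ ∖-⊑ R (bad u) v)
         (λ v → few v ∘ ∖-⊑ R (bad u) v)
         (+-cancelˡ-≤ m _ _ (≤-trans large (≤-trans (≤-reflexive (cong (c *_) (sumOn-split R (bad u) (const 1))))
           (≤-trans (≤-reflexive (*-distribˡ-+ c (card (R ⩕ bad u)) (card (R ∖ bad u)))) (+-monoˡ-≤ _ (≤-trans (*-monoʳ-≤ c (sumOn-⊑ {S = R ⩕ bad u} {S ⩕ bad u} λ v RBv →
             ∧-true⁺ (R⊑S v (proj₁ (∧-true⁻ RBv))) (proj₂ (∧-true⁻ {R v} RBv)))) (few u Ru)))))))
  = y , Ry , good′
  where
  y : Fin (suc j) → Fin n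
  y zero    = u
  y (suc i) = x i
  Ry : ∀ i → R (y i) ≡ true
  Ry zero    = Ru
  Ry (suc i) = ∖-⊑ R (bad u) (x i) (Rx i)
  good′ : ∀ i i′ → i <ᶠ i′ → bad (y i) (y i′) ≡ false
  good′ zero    (suc i′) _        = not-true⁻ (proj₂ (∧-true⁻ {R (x i′)} (Rx i′)))
  good′ (suc i) (suc i′) (s≤s lt) = good i i′ lt

-- A weak Turán bound: if at least half of S has few bad partners, a clique can be picked greedily there.
turan : (bad : Fin n → Fin n → Bool) (t : ℕ) (S : Subset n) →
  ¬ (Σ (Fin t → Fin n) λ x → (∀ i → S (x i) ≡ true) × (∀ i i′ → i <ᶠ i′ → bad (x i) (x i′) ≡ false)) →
  card S * card S ≤ 4 * t * sumOn S (λ u → card (S ⩕ bad u))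
turan {n} bad t S noClique with card S in eq
... | zero  = z≤n
... | suc _ = subst (λ m → m * m ≤ 4 * t * sumOn S (λ u → card (S ⩕ bad u))) eq by-cases
  where
  m = card S
  few : Subset n
  -- At `m / 2t` bad partners per vertex, `t` picks delete at most `m / 2`. If instead half of `S`
  -- exceeds this value, the bad pairs number at least `(m / 2) * (m / 2t)`, whence the constant
  -- `4 * t`.
  few u = 2 * t * card (S ⩕ bad u) ≤ᵇ m
  open ≤-Reasoning
  regroup : ∀ t x → 2 * (2 * t * x) ≡ 4 * t * x
  regroup = solve-∀
  regroup′ : ∀ t x → 2 * t * x ≡ t * (2 * x)
  regroup′ = solve-∀
  many : m ≤ 2 * card (S ∖ few) → m * m ≤ 4 * t * sumOn S (λ u → card (S ⩕ bad u))
  many half = begin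
    m * m                                                         ≤⟨ *-monoˡ-≤ m half ⟩
    2 * card (S ∖ few) * m                                        ≡⟨ *-assoc 2 (card (S ∖ few)) m ⟩
    2 * (card (S ∖ few) * m)                                      ≡⟨ cong (2 *_) (sumOn-const (S ∖ few) m) ⟨
    2 * sumOn (S ∖ few) (const m)                                 ≤⟨ *-monoʳ-≤ 2 (sumOn-mono (S ∖ few) λ u Su →
                                                                       <⇒≤ (≤ᵇ-false⁻ (not-true⁻ (proj₂ (∧-true⁻ {S u} Su))))) ⟩
    2 * sumOn (S ∖ few) (λ u → 2 * t * card (S ⩕ bad u))          ≤⟨ *-monoʳ-≤ 2 (sumOn-⊑ (∖-⊑ S few)) ⟩
    2 * sumOn S (λ u → 2 * t * card (S ⩕ bad u))                  ≡⟨ cong (2 *_) (sumOn-* S (2 * t) _) ⟩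
    2 * (2 * t * sumOn S (λ u → card (S ⩕ bad u)))                ≡⟨ regroup t _ ⟩
    4 * t * sumOn S (λ u → card (S ⩕ bad u))                      ∎
  by-cases : m * m ≤ 4 * t * sumOn S (λ u → card (S ⩕ bad u))
  by-cases with ≤-total m (2 * card (S ∖ few))
  ... | inj₁ half = many half
  ... | inj₂ less = contradiction
    (let x , Sx , good = greedy-clique bad S (2 * t) m (subst (0 <_) (≡-sym eq) (s≤s z≤n)) t (S ⩕ few) (⩕-⊑ˡ S few)
           (λ u Su → ≤ᵇ-true⁻ (proj₂ (∧-true⁻ {S u} Su)))
           (≤-trans (*-monoʳ-≤ t half) (≤-reflexive (≡-sym (regroup′ t _))))
     in x , (λ i → ⩕-⊑ˡ S few (x i) (Sx i)) , good) noClique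
    where
    double : ∀ x y → 2 * (x + y) ≡ 2 * x + 2 * y
    double = solve-∀
    twice : ∀ x → x + x ≡ 2 * x
    twice = solve-∀
    half : m ≤ 2 * card (S ⩕ few)
    half = +-cancelʳ-≤ m _ _ (begin
      m + m                                        ≡⟨ twice m ⟩
      2 * m                                        ≡⟨ cong (2 *_) (sumOn-split S few (const 1)) ⟩
      2 * (card (S ⩕ few) + card (S ∖ few))        ≡⟨ double (card (S ⩕ few)) _ ⟩
      2 * card (S ⩕ few) + 2 * card (S ∖ few)      ≤⟨ +-monoʳ-≤ (2 * card (S ⩕ few)) less ⟩
      2 * card (S ⩕ few) + m                       ∎)

-- Degrees, codegrees and two criteria for a subdivision

deg : Graph n → Subset n → Fin n → ℕ
deg G R u = sumOn R λ v → 𝟙 (adj G u v)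

codeg : Graph n → Subset n → Fin n → Fin n → ℕ
codeg G L u v = sumOn L λ b → 𝟙 (adj G b u) * 𝟙 (adj G b v)

edgesBetween : Graph n → Subset n → Subset n → ℕ
edgesBetween G S R = sumOn S (deg G R)

codeg-sym : (G : Graph n) (L : Subset n) (u v : Fin n) → codeg G L u v ≡ codeg G L v u
codeg-sym G L u v = sumOn-cong L λ b → *-comm (𝟙 (adj G b u)) (𝟙 (adj G b v))

edgesBetween-sym : (G : Graph n) (S R : Subset n) → edgesBetween G S R ≡ edgesBetween G R S
edgesBetween-sym G S R = trans (sumOn-swap S R _) (sumOn-cong R λ v → sumOn-cong S λ u → cong 𝟙 (sym G u v))

-- x embeds the slots Fin t, and f subdivides the edge {a v , b v} of the complete graph on them.
record Subdivision {k t : ℕ} (G : Graph n) (a b : Fin k → Fin t) : Set where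
  field
    x       : Fin t → Fin n
    f       : Fin k → Fin n
    x-inj   : Injective _≡_ _≡_ x
    f-inj   : Injective _≡_ _≡_ f
    f≢x     : ∀ v i → f v ≢ x i
    f~a     : ∀ v → adj G (f v) (x (a v)) ≡ true
    f~b     : ∀ v → adj G (f v) (x (b v)) ≡ true

commonNbrs : Graph n → Subset n → Fin n → Fin n → Subset n
commonNbrs G L u v = L ⩕ λ b → adj G b u ∧ adj G b v

card-commonNbrs : (G : Graph n) (L : Subset n) (u v : Fin n) → card (commonNbrs G L u v) ≡ codeg G L u v
card-commonNbrs G L u v = trans (card-⩕ L _) (sumOn-cong L λ b → 𝟙-∧ (adj G b u) (adj G b v))
  where
  𝟙-∧ : ∀ p q → 𝟙 (p ∧ q) ≡ 𝟙 p * 𝟙 q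
  𝟙-∧ true  q = ≡-sym (+-identityʳ (𝟙 q))
  𝟙-∧ false q = refl

increasing⇒injective : ∀ {t} (x : Fin t → Fin n) → (∀ i j → i <ᶠ j → x i ≢ x j) → Injective _≡_ _≡_ x
increasing⇒injective x ne {i} {j} eq with F.<-cmp i j
... | tri< i<j _ _ = contradiction eq (ne i j i<j)
... | tri≈ _ i≡j _ = i≡j
... | tri> _ _ j<i = contradiction (≡-sym eq) (ne j i j<i)

symmetric-pairs : ∀ {t} {Q : Fin t → Fin t → Set} → (∀ i j → Q i j → Q j i) → (∀ i j → i <ᶠ j → Q i j) → ∀ i j → i ≢ j → Q i j
symmetric-pairs swap inc i j i≢j with F.<-cmp i j
... | tri< i<j _ _ = inc i j i<j
... | tri≈ _ i≡j _ = contradiction i≡j i≢j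
... | tri> _ _ j<i = swap j i (inc j i j<i)

-- A codegree of `t + k` leaves room to avoid the `t` slots and all previously chosen links.
heavy⇒subdivision : ∀ {k t} (G : Graph n) (L : Subset n) (a b : Fin k → Fin t) → (∀ v → a v ≢ b v) →
  (x : Fin t → Fin n) → (∀ i j → i <ᶠ j → x i ≢ x j) → (∀ i j → i <ᶠ j → t + k ≤ codeg G L (x i) (x j)) →
  Subdivision G a b
heavy⇒subdivision {k = k} {t} G L a b a≢b x ne heavy
  with f , Ff , f∉ , f-inj ← distinct-representatives (λ v → commonNbrs G L (x (a v)) (x (b v))) (tabulate x)
         (λ v → ≤-trans (≤-reflexive (cong (_+ k) (length-tabulate x)))
           (≤-trans (symmetric-pairs {Q = λ i j → t + k ≤ codeg G L (x i) (x j)} (λ i j → subst (t + k ≤_) (codeg-sym G L (x i) (x j))) heavy (a v) (b v) (a≢b v))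
             (≤-reflexive (≡-sym (card-commonNbrs G L _ _)))))
  = record
  { x = x ; f = f ; x-inj = increasing⇒injective x ne ; f-inj = f-inj
  ; f≢x = λ v i eq → f∉ v (subst (_∈ tabulate x) (≡-sym eq) (∈-tabulate⁺ i))
  ; f~a = λ v → proj₁ (∧-true⁻ (proj₂ (∧-true⁻ {L (f v)} (Ff v))))
  ; f~b = λ v → proj₂ (∧-true⁻ {adj G (f v) (x (a v))} (proj₂ (∧-true⁻ {L (f v)} (Ff v))))
  }

NoCommonNbr : Graph n → Subset n → Fin n → Fin n → Fin n → Set
NoCommonNbr G L u v w = ∀ b → L b ≡ true → adj G b u ≡ true → adj G b v ≡ true → adj G b w ≢ true

symmetric-triples : ∀ {t} {Q : Fin t → Fin t → Fin t → Set} →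
  (∀ i j l → Q i j l → Q j i l) → (∀ i j l → Q i j l → Q i l j) →
  (∀ i j l → i <ᶠ j → j <ᶠ l → Q i j l) → ∀ i j l → i ≢ j → i ≢ l → j ≢ l → Q i j l
symmetric-triples {Q = Q} swap₁ swap₂ inc i j l i≢j i≢l j≢l with F.<-cmp i j | F.<-cmp j l | F.<-cmp i l
... | tri≈ _ eq _ | _ | _ = contradiction eq i≢j
... | _ | tri≈ _ eq _ | _ = contradiction eq j≢l
... | _ | _ | tri≈ _ eq _ = contradiction eq i≢l
... | tri< i<j _ _ | tri< j<l _ _ | _             = inc i j l i<j j<l
... | tri< i<j _ _ | tri> _ _ l<j | tri< i<l _ _  = swap₂ i l j (inc i l j i<l l<j)
... | tri< i<j _ _ | tri> _ _ l<j | tri> _ _ l<i  = swap₂ i l j (swap₁ l i j (inc l i j l<i i<j))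
... | tri> _ _ j<i | tri< j<l _ _ | tri< i<l _ _  = swap₁ j i l (inc j i l j<i i<l)
... | tri> _ _ j<i | tri< j<l _ _ | tri> _ _ l<i  = swap₁ j i l (swap₂ j l i (inc j l i j<l l<i))
... | tri> _ _ j<i | tri> _ _ l<j | _             =
  swap₁ j i l (swap₂ j l i (swap₁ l j i (inc l j i l<j j<i)))

-- Here a single common neighbour per pair must serve as the link. `independent` keeps links off the
-- slots, since a link is adjacent to a slot, and `no-triple` keeps links of different pairs apart.
-- Only increasing indices are asked for, matching the order in which slots are chosen.
record LightSystem {t : ℕ} (G : Graph n) (L : Subset n) (x : Fin t → Fin n) : Set where
  field
    distinct    : ∀ i j → i <ᶠ j → x i ≢ x j
    independent : ∀ i j → i <ᶠ j → adj G (x i) (x j) ≡ false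
    linked      : ∀ i j → i <ᶠ j → 0 < codeg G L (x i) (x j)
    no-triple   : ∀ i j l → i <ᶠ j → j <ᶠ l → NoCommonNbr G L (x i) (x j) (x l)

-- If `f v` and `f w` coincide, this vertex sees the slots `a v`, `b v`, `a w` and `b w`. By
-- `no-triple` only two of them are distinct, so the two pairs agree, in the same or in the opposite
-- order, and `parallel` or `crossed` applies.
light⇒subdivision : ∀ {k t} (G : Graph n) (L : Subset n) (a b : Fin k → Fin t) → (∀ v → a v ≢ b v) →
  (∀ v w → a v ≡ a w → b v ≡ b w → v ≡ w) → (∀ v w → a v ≡ b w → b v ≡ a w → v ≡ w) →
  (x : Fin t → Fin n) → LightSystem G L x → Subdivision G a b
light⇒subdivision {n} {k} {t} G L a b a≢b parallel crossed x sys = record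
  { x = x ; f = f ; x-inj = increasing⇒injective x distinct ; f-inj = f-inj ; f≢x = f≢x ; f~a = f~a ; f~b = f~b }
  where
  open LightSystem sys
  link : ∀ v → ∃ λ c → commonNbrs G L (x (a v)) (x (b v)) c ≡ true
  link v = card>0⇒∃ _ (subst (0 <_) (≡-sym (card-commonNbrs G L _ _))
    (symmetric-pairs {Q = λ i j → 0 < codeg G L (x i) (x j)} (λ i j → subst (0 <_) (codeg-sym G L (x i) (x j))) linked (a v) (b v) (a≢b v)))
  f : Fin k → Fin n
  f v = proj₁ (link v)
  f∈L : ∀ v → L (f v) ≡ true
  f∈L v = proj₁ (∧-true⁻ (proj₂ (link v)))
  f~a : ∀ v → adj G (f v) (x (a v)) ≡ true
  f~a v = proj₁ (∧-true⁻ (proj₂ (∧-true⁻ {L (f v)} (proj₂ (link v)))))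
  f~b : ∀ v → adj G (f v) (x (b v)) ≡ true
  f~b v = proj₂ (∧-true⁻ {adj G (f v) (x (a v))} (proj₂ (∧-true⁻ {L (f v)} (proj₂ (link v)))))
  nonadjacent : ∀ i j → adj G (x i) (x j) ≡ false
  nonadjacent i j with i F.≟ j
  ... | yes refl = irrefl G (x i)
  ... | no  i≢j  = symmetric-pairs {Q = λ i j → adj G (x i) (x j) ≡ false}
                     (λ i j → trans (sym G (x j) (x i))) independent i j i≢j
  f≢x : ∀ v i → f v ≢ x i
  f≢x v i eq = true≢false (f~a v) (trans (cong (λ y → adj G y (x (a v))) eq) (nonadjacent i (a v)))
  triple : ∀ i j l → i ≢ j → i ≢ l → j ≢ l → NoCommonNbr G L (x i) (x j) (x l)
  triple = symmetric-triples {Q = λ i j l → NoCommonNbr G L (x i) (x j) (x l)}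
    (λ i j l none c c∈L cj ci cl → none c c∈L ci cj cl)
    (λ i j l none c c∈L ci cl cj → none c c∈L ci cj cl) no-triple
  f-inj : Injective _≡_ _≡_ f
  f-inj {v} {w} eq with f~a′ ← subst (λ y → adj G y (x (a w)) ≡ true) (≡-sym eq) (f~a w)
                   | f~b′ ← subst (λ y → adj G y (x (b w)) ≡ true) (≡-sym eq) (f~b w)
    with a v F.≟ a w | a v F.≟ b w | b v F.≟ a w | b v F.≟ b w
  ... | yes p | _     | _     | yes q = parallel v w p q
  ... | _     | yes p | yes q | _     = crossed v w p q
  ... | no p  | _     | no q  | _     = contradiction f~a′ (triple (a v) (b v) (a w) (a≢b v) p q (f v) (f∈L v) (f~a v) (f~b v))
  ... | _     | no p  | _     | no q  = contradiction f~b′ (triple (a v) (b v) (b w) (a≢b v) p q (f v) (f∈L v) (f~a v) (f~b v))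
  ... | yes p | yes q | _     | _     = contradiction (trans (≡-sym p) q) (a≢b w)
  ... | _     | _     | yes p | yes q = contradiction (trans (≡-sym p) q) (a≢b w)

-- Light pairs and the greedy choice of slots

-- Each greedy step shrinks the candidate set U by at most a factor N shrink / δ², provided δ |U| ≥ threshold N.
opaque
  shrink : ℕ → ℕ → ℕ
  shrink t T = 16 * t * T

  threshold : ℕ → ℕ → ℕ → ℕ
  threshold t T D = shrink t T * ((1 + t * T) * D)

  threshold-def : ∀ t T D → threshold t T D ≡ shrink t T * ((1 + t * T) * D)
  threshold-def t T D = refl

  shrink-double : ∀ t T N l → 8 * t * N * T * l + 8 * t * N * T * l ≡ shrink t T * N * l
  shrink-double = identity
    where
    identity : ∀ t T N l → 8 * t * N * T * l + 8 * t * N * T * l ≡ 16 * t * T * N * l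
    identity = solve-∀

  shrink≢0 : ∀ t T .{{_ : NonZero t}} .{{_ : NonZero T}} → NonZero (shrink t T)
  shrink≢0 t T = m*n≢0 (16 * t) T {{m*n≢0 16 t}}

  threshold≢0 : ∀ t T D .{{_ : NonZero t}} .{{_ : NonZero T}} .{{_ : NonZero D}} → NonZero (threshold t T D)
  threshold≢0 t T D = m*n≢0 (shrink t T) ((1 + t * T) * D) {{shrink≢0 t T}} {{m*n≢0 (1 + t * T) D}}

  8t≤threshold : ∀ t T D .{{_ : NonZero t}} .{{_ : NonZero T}} .{{_ : NonZero D}} → 8 * t ≤ threshold t T D
  8t≤threshold t T D = ≤-trans (*-monoˡ-≤ t (m≤m+n 8 8)) (≤-trans (m≤m*n (16 * t) T)
    (m≤m*n (shrink t T) ((1 + t * T) * D) {{m*n≢0 (1 + t * T) D}}))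

module _ {n : ℕ} (G : Graph n) (L : Subset n) (T : ℕ) where

  -- The diagonal counts as bad, so that a clique avoiding bad pairs consists of distinct vertices.
  -- This costs one extra partner per vertex.
  nonheavy : Fin n → Fin n → Bool
  nonheavy u v = (u == v) ∨ not (T ≤ᵇ codeg G L u v)

  light : Fin n → Fin n → Bool
  light u v = not (u == v) ∧ (not (T ≤ᵇ codeg G L u v) ∧ (1 ≤ᵇ codeg G L u v))

  nonheavy-false⁻ : ∀ {u v} → nonheavy u v ≡ false → u ≢ v × T ≤ codeg G L u v
  nonheavy-false⁻ {u} {v} eq with u == v in e | T ≤ᵇ codeg G L u v in e′
  ... | false | true = ==-false⁻ e , ≤ᵇ-true⁻ e′

  light-true⁻ : ∀ {u v} → light u v ≡ true → u ≢ v × codeg G L u v ≤ T × 0 < codeg G L u v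
  light-true⁻ {u} {v} eq with u == v in e | T ≤ᵇ codeg G L u v in e′ | 1 ≤ᵇ codeg G L u v in e″
  ... | false | false | true = ==-false⁻ e , <⇒≤ (≤ᵇ-false⁻ e′) , ≤ᵇ-true⁻ e″

  offDiagonal : Fin n → Fin n → Bool
  offDiagonal u v = not (u == v) ∧ not (T ≤ᵇ codeg G L u v)

  nonheavy≤ : ∀ u v → 𝟙 (nonheavy u v) ≤ 𝟙 (u == v) + 𝟙 (offDiagonal u v)
  nonheavy≤ u v with u == v
  ... | true  = s≤s z≤n
  ... | false = ≤-refl

  -- A pair of distinct vertices that is not heavy is either light, hence spanned by at most `T`
  -- cherries, or has no common neighbour and spans none.
  codeg*offDiagonal≤ : ∀ u v → codeg G L u v * 𝟙 (offDiagonal u v) ≤ T * 𝟙 (light u v)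
  codeg*offDiagonal≤ u v with u == v | T ≤ᵇ codeg G L u v in e | 1 ≤ᵇ codeg G L u v in e′
  ... | true  | _     | _     = ≤-trans (≤-reflexive (*-zeroʳ (codeg G L u v))) z≤n
  ... | false | true  | _     = ≤-trans (≤-reflexive (*-zeroʳ (codeg G L u v))) z≤n
  ... | false | false | true  = *-monoˡ-≤ 1 {codeg G L u v} {T} (<⇒≤ (≤ᵇ-false⁻ {T} e))
  ... | false | false | false = ≤-trans (*-monoˡ-≤ 1 {codeg G L u v} {0} (≤-pred (≤ᵇ-false⁻ {1} e′))) z≤n

  -- Cherries centred in L: Cauchy–Schwarz makes them numerous, and by turan a positive
  -- proportion of them spans pairs that are not heavy.
  many-light-pairs : (t N : ℕ) (U : Subset n) → card L ≤ N →
    (∀ (x : Fin t → Fin n) → ¬ (∀ i j → i <ᶠ j → x i ≢ x j × T ≤ codeg G L (x i) (x j))) →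
    8 * t * N ≤ edgesBetween G U L →
    edgesBetween G U L * edgesBetween G U L ≤ 8 * t * N * T * sumOn U (λ u → card (U ⩕ light u))
  many-light-pairs t N U cardL noHeavy large = +-cancelˡ-≤ (W * W) _ _ (begin
    W * W + W * W                                ≡⟨ twice (W * W) ⟩
    2 * (W * W)                                  ≤⟨ *-monoʳ-≤ 2 W²≤ ⟩
    2 * (N * (4 * t * (W + T * Λ)))              ≡⟨ expand t N T W Λ ⟩
    -- The term linear in `W` comes from the diagonal; `8 * t * N ≤ W` absorbs it into one of the
    -- two copies of `W * W`.
    8 * t * N * W + 8 * t * N * T * Λ            ≤⟨ +-monoˡ-≤ _ (*-monoˡ-≤ W large) ⟩
    W * W + 8 * t * N * T * Λ                    ∎)
    where
    open ≤-Reasoning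
    W = edgesBetween G U L
    Λ = sumOn U (λ u → card (U ⩕ light u))
    twice : ∀ x → x + x ≡ 2 * x
    twice = solve-∀
    expand : ∀ t N T W Λ → 2 * (N * (4 * t * (W + T * Λ))) ≡ 8 * t * N * W + 8 * t * N * T * Λ
    expand = solve-∀
    A : Fin n → Subset n
    A b = U ⩕ adj G b
    s : Fin n → ℕ
    s b = card (A b)
    W≡ : sumOn L s ≡ W
    W≡ = trans (sumOn-cong L λ b → card-⩕ U (adj G b)) (edgesBetween-sym G L U)
    pairs : Fin n → ℕ
    pairs b = sumOn (A b) λ u → sumOn (A b) λ v → 𝟙 (offDiagonal u v)
    s²≤ : ∀ b → s b * s b ≤ 4 * t * (s b + pairs b)
    s²≤ b = ≤-trans
      (turan nonheavy t (A b) λ (x , _ , good) → noHeavy x λ i j i<j → nonheavy-false⁻ (good i j i<j))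
      (*-monoʳ-≤ (4 * t) (≤-trans (sumOn-mono (A b) λ u _ → row u) (≤-reflexive (sumOn-+ (A b) (const 1) _))))
      where
      row : ∀ u → card (A b ⩕ nonheavy u) ≤ 1 + sumOn (A b) (λ v → 𝟙 (offDiagonal u v))
      row u = begin
        card (A b ⩕ nonheavy u)                                             ≡⟨ card-⩕ (A b) (nonheavy u) ⟩
        sumOn (A b) (λ v → 𝟙 (nonheavy u v))                                ≤⟨ sumOn-mono (A b) (λ v _ → nonheavy≤ u v) ⟩
        sumOn (A b) (λ v → 𝟙 (u == v) + 𝟙 (offDiagonal u v))                ≡⟨ sumOn-+ (A b) _ _ ⟩
        sumOn (A b) (λ v → 𝟙 (u == v)) + sumOn (A b) (λ v → 𝟙 (offDiagonal u v)) ≤⟨ +-monoˡ-≤ _ (≤-trans (≤-reflexive (≡-sym (card-⩕ (A b) (u ==_)))) (card-⩕-== (A b) u)) ⟩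
        1 + sumOn (A b) (λ v → 𝟙 (offDiagonal u v))                         ∎
    expand-pairs : ∀ b → pairs b ≡ sumOn U λ u → sumOn U λ v → 𝟙 (adj G b u) * 𝟙 (adj G b v) * 𝟙 (offDiagonal u v)
    expand-pairs b = trans (sumOn-⩕ U (adj G b) _) (sumOn-cong U λ u →
      trans (cong (𝟙 (adj G b u) *_) (sumOn-⩕ U (adj G b) _)) (trans (≡-sym (sumOn-* U (𝟙 (adj G b u)) _))
        (sumOn-cong U λ v → ≡-sym (*-assoc (𝟙 (adj G b u)) (𝟙 (adj G b v)) _))))
    pairs≤ : sumOn L pairs ≤ T * Λ
    pairs≤ = begin
      sumOn L pairs                                                         ≡⟨ sumOn-cong L expand-pairs ⟩
      sumOn L (λ b → sumOn U λ u → sumOn U λ v → 𝟙 (adj G b u) * 𝟙 (adj G b v) * 𝟙 (offDiagonal u v)) ≡⟨ sumOn-swap L U _ ⟩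
      sumOn U (λ u → sumOn L λ b → sumOn U λ v → 𝟙 (adj G b u) * 𝟙 (adj G b v) * 𝟙 (offDiagonal u v)) ≡⟨ sumOn-cong U (λ u → sumOn-swap L U _) ⟩
      sumOn U (λ u → sumOn U λ v → sumOn L λ b → 𝟙 (adj G b u) * 𝟙 (adj G b v) * 𝟙 (offDiagonal u v)) ≡⟨ sumOn-cong U (λ u → sumOn-cong U λ v → sumOn-*ʳ L (𝟙 (offDiagonal u v)) _) ⟩
      sumOn U (λ u → sumOn U λ v → codeg G L u v * 𝟙 (offDiagonal u v))     ≤⟨ sumOn-mono U (λ u _ → sumOn-mono U λ v _ → codeg*offDiagonal≤ u v) ⟩
      sumOn U (λ u → sumOn U λ v → T * 𝟙 (light u v))                       ≡⟨ sumOn-cong U (λ u → trans (sumOn-* U T _) (cong (T *_) (≡-sym (card-⩕ U (light u))))) ⟩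
      sumOn U (λ u → T * card (U ⩕ light u))                                ≡⟨ sumOn-* U T _ ⟩
      T * Λ                                                                 ∎
    W²≤ : W * W ≤ N * (4 * t * (W + T * Λ))
    W²≤ = begin
      W * W                                          ≡⟨ cong₂ _*_ W≡ W≡ ⟨
      sumOn L s * sumOn L s                          ≤⟨ cauchy-schwarz L s ⟩
      card L * sumOn L (λ b → s b * s b)             ≤⟨ *-mono-≤ cardL (sumOn-mono L λ b _ → s²≤ b) ⟩
      N * sumOn L (λ b → 4 * t * (s b + pairs b))    ≡⟨ cong (N *_) (trans (sumOn-* L (4 * t) _) (cong (4 * t *_) (sumOn-+ L s pairs))) ⟩
      N * (4 * t * (sumOn L s + sumOn L pairs))      ≤⟨ *-monoʳ-≤ N (*-monoʳ-≤ (4 * t) (+-mono-≤ (≤-reflexive W≡) pairs≤)) ⟩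
      N * (4 * t * (W + T * Λ))                      ∎

  many-light-neighbours : (t N δ : ℕ) (U : Subset n) → card L ≤ N →
    (∀ (x : Fin t → Fin n) → ¬ (∀ i j → i <ᶠ j → x i ≢ x j × T ≤ codeg G L (x i) (x j))) →
    (∀ u → U u ≡ true → δ ≤ deg G L u) → 0 < card U → 8 * t * N ≤ δ * card U →
    ∃ λ u → U u ≡ true × δ * (δ * card U) ≤ 8 * t * N * T * card (U ⩕ light u)
  many-light-neighbours t N δ U cardL noHeavy min pos large =
    average U (const (δ * (δ * card U))) (λ u → 8 * t * N * T * card (U ⩕ light u)) pos (begin
      sumOn U (const (δ * (δ * card U)))                          ≡⟨ sumOn-const U _ ⟩
      card U * (δ * (δ * card U))                                 ≡⟨ regroup (card U) δ ⟩
      δ * card U * (δ * card U)                                   ≤⟨ *-mono-≤ W≥ W≥ ⟩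
      edgesBetween G U L * edgesBetween G U L                     ≤⟨ many-light-pairs t N U cardL noHeavy (≤-trans large W≥) ⟩
      8 * t * N * T * sumOn U (λ u → card (U ⩕ light u))          ≡⟨ sumOn-* U (8 * t * N * T) _ ⟨
      sumOn U (λ u → 8 * t * N * T * card (U ⩕ light u))          ∎)
    where
    open ≤-Reasoning
    regroup : ∀ c d → c * (d * (d * c)) ≡ d * c * (d * c)
    regroup = solve-∀
    W≥ : δ * card U ≤ edgesBetween G U L
    W≥ = ≤-trans (≤-reflexive (trans (*-comm δ (card U)) (≡-sym (sumOn-const U δ)))) (sumOn-mono U min)

  -- Counted with multiplicity, over old slots `p` and vertices `b` adjacent to `p`, `u` and `v`. A
  -- count can be summed over `v` by exchanging sums, and its vanishing is the `no-triple` condition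
  -- for `u`, `v` and the old slots.
  conflicts : List (Fin n) → Fin n → Fin n → ℕ
  conflicts []       u v = 0
  conflicts (p ∷ ps) u v = sumOn L (λ b → 𝟙 (adj G b p) * 𝟙 (adj G b u) * 𝟙 (adj G b v)) + conflicts ps u v

  conflicts≡0⁻ : ∀ ps u v → conflicts ps u v ≡ 0 → ∀ p → p ∈ ps → NoCommonNbr G L p u v
  conflicts≡0⁻ (p ∷ ps) u v eq .p (here refl) b b∈L bp bu bv = contradiction
    (≤-trans (one b∈L bp bu bv) (≤-reflexive (m+n≡0⇒m≡0 _ eq))) λ ()
    where
    one : ∀ {b} → L b ≡ true → adj G b p ≡ true → adj G b u ≡ true → adj G b v ≡ true →
      1 ≤ sumOn L (λ b → 𝟙 (adj G b p) * 𝟙 (adj G b u) * 𝟙 (adj G b v))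
    one {b} b∈L bp bu bv = ≤-trans
      (≤-reflexive (≡-sym (cong₂ _*_ (cong₂ _*_ (cong 𝟙 bp) (cong 𝟙 bu)) (cong 𝟙 bv))))
      (sumOn-term L (λ b → 𝟙 (adj G b p) * 𝟙 (adj G b u) * 𝟙 (adj G b v)) b b∈L)
  conflicts≡0⁻ (p ∷ ps) u v eq q (there q∈ps) = conflicts≡0⁻ ps u v (m+n≡0⇒n≡0 _ eq) q q∈ps

  -- For each old slot `p` there are at most `T` vertices `b` adjacent to both `p` and `u`, and each
  -- of them excludes at most `Δ` candidates.
  sum-conflicts : (U : Subset n) (Δ : ℕ) → U ⊑ L → (∀ b → L b ≡ true → deg G L b ≤ Δ) →
    ∀ ps u → (∀ p → p ∈ ps → codeg G L p u ≤ T) → sumOn U (conflicts ps u) ≤ length ps * (T * Δ)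
  sum-conflicts U Δ U⊑L max [] u _ = ≤-reflexive (trans (sumOn-const U 0) (*-zeroʳ (card U)))
  sum-conflicts U Δ U⊑L max (p ∷ ps) u codeg≤ = begin
    sumOn U (conflicts (p ∷ ps) u)                                                 ≡⟨ sumOn-+ U _ _ ⟩
    sumOn U (λ v → sumOn L λ b → 𝟙 (adj G b p) * 𝟙 (adj G b u) * 𝟙 (adj G b v)) + sumOn U (conflicts ps u)
      ≤⟨ +-mono-≤ first (sum-conflicts U Δ U⊑L max ps u λ q → codeg≤ q ∘ there) ⟩
    T * Δ + length ps * (T * Δ)                                                    ∎
    where
    open ≤-Reasoning
    first : sumOn U (λ v → sumOn L λ b → 𝟙 (adj G b p) * 𝟙 (adj G b u) * 𝟙 (adj G b v)) ≤ T * Δ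
    first = begin
      sumOn U (λ v → sumOn L λ b → 𝟙 (adj G b p) * 𝟙 (adj G b u) * 𝟙 (adj G b v))  ≡⟨ sumOn-swap U L _ ⟩
      sumOn L (λ b → sumOn U λ v → 𝟙 (adj G b p) * 𝟙 (adj G b u) * 𝟙 (adj G b v))  ≡⟨ sumOn-cong L (λ b → sumOn-* U (𝟙 (adj G b p) * 𝟙 (adj G b u)) _) ⟩
      sumOn L (λ b → 𝟙 (adj G b p) * 𝟙 (adj G b u) * deg G U b)                    ≤⟨ sumOn-mono L (λ b b∈L → *-monoʳ-≤ (𝟙 (adj G b p) * 𝟙 (adj G b u)) (≤-trans (sumOn-⊑ U⊑L) (max b b∈L))) ⟩
      sumOn L (λ b → 𝟙 (adj G b p) * 𝟙 (adj G b u) * Δ)                            ≡⟨ sumOn-*ʳ L Δ _ ⟩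
      codeg G L p u * Δ                                                            ≤⟨ *-monoˡ-≤ Δ (codeg≤ p (here refl)) ⟩
      T * Δ                                                                        ∎

  remaining : Subset n → List (Fin n) → Fin n → Subset n
  remaining U ps u = U ⩕ λ v → light u v ∧ (not (adj G u v) ∧ (conflicts ps u v ≤ᵇ 0))

  remaining-true⁻ : ∀ U ps u v → remaining U ps u v ≡ true →
    U v ≡ true × light u v ≡ true × adj G u v ≡ false × conflicts ps u v ≡ 0
  remaining-true⁻ U ps u v eq with U v | light u v | adj G u v | conflicts ps u v ≤ᵇ 0 in e
  ... | true | true | false | true = refl , refl , refl , n≤0⇒n≡0 (≤ᵇ-true⁻ e)

  remaining-⊑ : ∀ U ps u → remaining U ps u ⊑ U
  remaining-⊑ U ps u v = proj₁ ∘ remaining-true⁻ U ps u v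

  remaining-large : ∀ U ps u → card (U ⩕ light u) ≤ card (remaining U ps u) + (deg G U u + sumOn U (conflicts ps u))
  remaining-large U ps u = begin
    card (U ⩕ light u)                                                      ≡⟨ card-⩕ U _ ⟩
    sumOn U (λ v → 𝟙 (light u v))                                           ≤⟨ sumOn-mono U (λ v _ → pointwise v) ⟩
    sumOn U (λ v → 𝟙 (keep v) + (𝟙 (adj G u v) + conflicts ps u v))         ≡⟨ sumOn-+ U _ _ ⟩
    sumOn U (λ v → 𝟙 (keep v)) + sumOn U (λ v → 𝟙 (adj G u v) + conflicts ps u v) ≡⟨ cong₂ _+_ (≡-sym (card-⩕ U keep)) (sumOn-+ U _ _) ⟩
    card (remaining U ps u) + (deg G U u + sumOn U (conflicts ps u))        ∎
    where
    open ≤-Reasoning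
    keep : Subset n
    keep v = light u v ∧ (not (adj G u v) ∧ (conflicts ps u v ≤ᵇ 0))
    pointwise : ∀ v → 𝟙 (light u v) ≤ 𝟙 (keep v) + (𝟙 (adj G u v) + conflicts ps u v)
    pointwise v with light u v | adj G u v | conflicts ps u v ≤ᵇ 0 in e
    ... | false | _     | _     = z≤n
    ... | true  | true  | _     = s≤s z≤n
    ... | true  | false | true  = s≤s z≤n
    ... | true  | false | false = ≤ᵇ-false⁻ e

  -- `ps` holds the slots already chosen. A triple with two old slots is settled when the second of
  -- them is chosen, through `remaining`; `old` records the triples with one old slot, and `system`
  -- those with none.
  record LightExtension (ps : List (Fin n)) (U : Subset n) (j : ℕ) : Set where
    field
      x      : Fin j → Fin n
      system : LightSystem G L x
      inside : ∀ i → U (x i) ≡ true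
      old    : ∀ p → p ∈ ps → ∀ i i′ → i <ᶠ i′ → NoCommonNbr G L p (x i) (x i′)

  extend : ∀ {ps U j} u → U u ≡ true → LightExtension (u ∷ ps) (remaining U ps u) j → LightExtension ps U (suc j)
  extend {ps} {U} {j} u Uu ext = record
    { x = y
    ; system = record { distinct = dist ; independent = indep ; linked = link ; no-triple = triple }
    ; inside = λ { zero → Uu ; (suc i) → proj₁ (rest i) }
    ; old = λ { p p∈ps zero    (suc i′) _        → conflicts≡0⁻ ps u (x i′) (proj₂ (proj₂ (proj₂ (rest i′)))) p p∈ps
              ; p p∈ps (suc i) (suc i′) (s≤s lt) → old p (there p∈ps) i i′ lt }
    }
    where
    open LightExtension ext
    open LightSystem system
    rest : ∀ i → U (x i) ≡ true × light u (x i) ≡ true × adj G u (x i) ≡ false × conflicts ps u (x i) ≡ 0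
    rest i = remaining-true⁻ U ps u (x i) (inside i)
    y : Fin (suc j) → Fin n
    y zero    = u
    y (suc i) = x i
    dist : ∀ i i′ → i <ᶠ i′ → y i ≢ y i′
    dist zero    (suc i′) _        = proj₁ (light-true⁻ (proj₁ (proj₂ (rest i′))))
    dist (suc i) (suc i′) (s≤s lt) = distinct i i′ lt
    indep : ∀ i i′ → i <ᶠ i′ → adj G (y i) (y i′) ≡ false
    indep zero    (suc i′) _        = proj₁ (proj₂ (proj₂ (rest i′)))
    indep (suc i) (suc i′) (s≤s lt) = independent i i′ lt
    link : ∀ i i′ → i <ᶠ i′ → 0 < codeg G L (y i) (y i′)
    link zero    (suc i′) _        = proj₂ (proj₂ (light-true⁻ (proj₁ (proj₂ (rest i′)))))
    link (suc i) (suc i′) (s≤s lt) = linked i i′ lt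
    triple : ∀ i i′ i″ → i <ᶠ i′ → i′ <ᶠ i″ → NoCommonNbr G L (y i) (y i′) (y i″)
    triple zero    (suc i′) (suc i″) _        (s≤s lt) = old u (here refl) i′ i″ lt
    triple (suc i) (suc i′) (suc i″) (s≤s l₁) (s≤s l₂) = no-triple i i′ i″ l₁ l₂

  module _ (t N D δ : ℕ) .{{_ : NonZero t}} .{{_ : NonZero T}} .{{_ : NonZero N}} .{{_ : NonZero D}}
    (cardL : card L ≤ N)
    (noHeavy : ∀ (x : Fin t → Fin n) → ¬ (∀ i j → i <ᶠ j → x i ≢ x j × T ≤ codeg G L (x i) (x j)))
    (max : ∀ b → L b ≡ true → deg G L b ≤ D * δ)
    where

    private
      sh th : ℕ
      sh = shrink t T
      th = threshold t T D

    threshold*N>0 : 0 < th * N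
    threshold*N>0 = >-nonZero⁻¹ (th * N) {{m*n≢0 th N {{threshold≢0 t T D}}}}

    -- Of the `ℓ` light partners of `u`, at most `(1 + t * T) * D * δ` are deleted: neighbours of
    -- `u` and conflicts with at most `t` old slots. Doubling the bound of `many-light-neighbours`
    -- gives `2δ² |U| ≤ sh * N * ℓ`, hence 16 in place of 8 in `shrink`. The value of `threshold`
    -- makes `sh * N` times the loss at most `δ² |U|`, so one copy of `δ² |U|` is left for the
    -- survivors.
    light-step : ∀ ps U → U ⊑ L → (∀ u → U u ≡ true → δ ≤ deg G L u) → length ps ≤ t →
      (∀ p u → p ∈ ps → U u ≡ true → codeg G L p u ≤ T) → th * N ≤ δ * card U →
      ∃ λ u → U u ≡ true × δ * (δ * card U) ≤ sh * N * card (remaining U ps u)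
    light-step ps U U⊑L min len codeg≤ large =
      let u , Uu , many = many-light-neighbours t N δ U cardL noHeavy min nonempty
                            (≤-trans (*-monoˡ-≤ N (8t≤threshold t T D)) large)
      in u , Uu , finish u Uu many
      where
      open ≤-Reasoning
      nonempty : 0 < card U
      nonempty = *-cancelˡ-< δ 0 (card U) (≤-trans (s≤s (≤-reflexive (*-zeroʳ δ))) (≤-trans threshold*N>0 large))
      ℓ : Fin n → ℕ
      ℓ u = card (U ⩕ light u)
      regroup : ∀ s N r m D d → s * N * (r + m * (D * d)) ≡ d * (s * (m * D) * N) + s * N * r
      regroup = solve-∀
      factor : ∀ t T x → x + t * (T * x) ≡ (1 + t * T) * x
      factor = solve-∀
      ℓ≤ : ∀ u → U u ≡ true → ℓ u ≤ card (remaining U ps u) + (1 + t * T) * (D * δ)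
      ℓ≤ u Uu = begin
        ℓ u                                                                ≤⟨ remaining-large U ps u ⟩
        card (remaining U ps u) + (deg G U u + sumOn U (conflicts ps u))   ≤⟨ +-monoʳ-≤ (card (remaining U ps u)) (+-mono-≤
                                                                                (≤-trans (sumOn-⊑ U⊑L) (max u (U⊑L u Uu)))
                                                                                (≤-trans (sum-conflicts U (D * δ) U⊑L max ps u λ p p∈ps → codeg≤ p u p∈ps Uu) (*-monoˡ-≤ _ len))) ⟩
        card (remaining U ps u) + (D * δ + t * (T * (D * δ)))              ≡⟨ cong (card (remaining U ps u) +_) (factor t T (D * δ)) ⟩
        card (remaining U ps u) + (1 + t * T) * (D * δ)                    ∎
      finish : ∀ u → U u ≡ true → δ * (δ * card U) ≤ 8 * t * N * T * card (U ⩕ light u) →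
        δ * (δ * card U) ≤ sh * N * card (remaining U ps u)
      finish u Uu many = +-cancelˡ-≤ (δ * (δ * card U)) _ _ (begin
        δ * (δ * card U) + δ * (δ * card U)                     ≤⟨ +-mono-≤ many many ⟩
        8 * t * N * T * ℓ u + 8 * t * N * T * ℓ u               ≡⟨ shrink-double t T N (ℓ u) ⟩
        sh * N * ℓ u                                        ≤⟨ *-monoʳ-≤ (sh * N) (ℓ≤ u Uu) ⟩
        sh * N * (card (remaining U ps u) + (1 + t * T) * (D * δ)) ≡⟨ regroup sh N (card (remaining U ps u)) (1 + t * T) D δ ⟩
        δ * (sh * ((1 + t * T) * D) * N) + sh * N * card (remaining U ps u) ≡⟨ cong (λ c → δ * (c * N) + sh * N * card (remaining U ps u)) (threshold-def t T D) ⟨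
        δ * (th * N) + sh * N * card (remaining U ps u)     ≤⟨ +-monoˡ-≤ _ (*-monoʳ-≤ δ large) ⟩
        δ * (δ * card U) + sh * N * card (remaining U ps u) ∎)

    threshold≤ : ∀ j → th * N ≤ sh ^ j * th * N * 1
    threshold≤ j = ≤-trans (*-monoˡ-≤ N (m≤n*m th (sh ^ j) {{m^n≢0 sh j {{shrink≢0 t T}}}}))
      (≤-reflexive (≡-sym (*-identityʳ (sh ^ j * th * N))))

    -- The hypothesis at `i` says that `δ |U|` can still be above the threshold after `i` further
    -- steps; its instance at `i + 1` becomes the one at `i` for the next candidate set. All `i ≤ j`
    -- are required because `δ²` and `N` are not compared, so that the last instance need not imply
    -- the earlier ones.
    greedy-light : ∀ j ps U → U ⊑ L → (∀ u → U u ≡ true → δ ≤ deg G L u) → length ps + j ≤ t →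
      (∀ p u → p ∈ ps → U u ≡ true → codeg G L p u ≤ T) →
      (∀ i → i ≤ j → sh ^ j * th * N * N ^ i ≤ δ * card U * (δ * δ) ^ i) →
      LightExtension ps U j
    greedy-light zero ps U U⊑L min len codeg≤ large = record
      { x = λ () ; inside = λ () ; old = λ _ _ ()
      ; system = record { distinct = λ () ; independent = λ () ; linked = λ () ; no-triple = λ () } }
    greedy-light (suc j) ps U U⊑L min len codeg≤ large =
      let u , Uu , shrunk = light-step ps U U⊑L min (m+n≤o⇒m≤o (length ps) len) codeg≤ enough
      in continue u Uu shrunk
      where
      open ≤-Reasoning
      enough : th * N ≤ δ * card U
      enough = ≤-trans (threshold≤ (suc j)) (≤-trans (large 0 z≤n) (≤-reflexive (*-identityʳ (δ * card U))))
      codeg≤′ : ∀ u p v → p ∈ u ∷ ps → remaining U ps u v ≡ true → codeg G L p v ≤ T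
      codeg≤′ u p v (here refl) rv = proj₁ (proj₂ (light-true⁻ (proj₁ (proj₂ (remaining-true⁻ U ps u v rv)))))
      codeg≤′ u p v (there p∈ps) rv = codeg≤ p v p∈ps (remaining-⊑ U ps u v rv)
      regroup₁ : ∀ s S c N P → s * N * (S * c * N * P) ≡ s * S * c * N * (N * P)
      regroup₁ = solve-∀
      regroup₂ : ∀ d c P → d * c * (d * d * P) ≡ d * (d * c) * (d * P)
      regroup₂ = solve-∀
      regroup₃ : ∀ s N r d P → s * N * r * (d * P) ≡ s * N * (d * r * P)
      regroup₃ = solve-∀
      large′ : ∀ u → δ * (δ * card U) ≤ sh * N * card (remaining U ps u) →
        ∀ i → i ≤ j → sh ^ j * th * N * N ^ i ≤ δ * card (remaining U ps u) * (δ * δ) ^ i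
      large′ u shrunk i i≤j = *-cancelˡ-≤ (sh * N) {{m*n≢0 sh N {{shrink≢0 t T}}}} (begin
        sh * N * (sh ^ j * th * N * N ^ i)                   ≡⟨ regroup₁ sh (sh ^ j) th N (N ^ i) ⟩
        sh ^ suc j * th * N * N ^ suc i                      ≤⟨ large (suc i) (s≤s i≤j) ⟩
        δ * card U * (δ * δ) ^ suc i                         ≡⟨ regroup₂ δ (card U) ((δ * δ) ^ i) ⟩
        δ * (δ * card U) * (δ * (δ * δ) ^ i)                 ≤⟨ *-monoˡ-≤ (δ * (δ * δ) ^ i) shrunk ⟩
        sh * N * card (remaining U ps u) * (δ * (δ * δ) ^ i) ≡⟨ regroup₃ sh N (card (remaining U ps u)) δ ((δ * δ) ^ i) ⟩
        sh * N * (δ * card (remaining U ps u) * (δ * δ) ^ i) ∎)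
      continue : ∀ u → U u ≡ true → δ * (δ * card U) ≤ sh * N * card (remaining U ps u) → LightExtension ps U (suc j)
      continue u Uu shrunk = extend u Uu (greedy-light j (u ∷ ps) (remaining U ps u)
        (λ v → U⊑L v ∘ remaining-⊑ U ps u v) (λ v → min v ∘ remaining-⊑ U ps u v)
        (≤-trans (≤-reflexive (≡-sym (+-suc (length ps) j))) len) (codeg≤′ u) (large′ u shrunk))

-- Arithmetic of exponents

^-cancelˡ-≤ : ∀ m {x y} .{{_ : NonZero m}} → x ^ m ≤ y ^ m → x ≤ y
^-cancelˡ-≤ m le = ≮⇒≥ λ y<x → <⇒≱ (^-monoˡ-< m y<x) le

^-distribʳ-* : ∀ m x y → (x * y) ^ m ≡ x ^ m * y ^ m
^-distribʳ-* zero    x y = refl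
^-distribʳ-* (suc m) x y = trans (cong (x * y *_) (^-distribʳ-* m x y)) (regroup x y (x ^ m) (y ^ m))
  where
  regroup : ∀ x y X Y → x * y * (X * Y) ≡ x * X * (y * Y)
  regroup = solve-∀

^-comm : ∀ x m l → (x ^ m) ^ l ≡ (x ^ l) ^ m
^-comm x m l = trans (^-*-assoc x m l) (trans (cong (x ^_) (*-comm m l)) (≡-sym (^-*-assoc x l m)))

-- Up to constants: e ≥ N^(r/m) and r/m ≥ α/β give e ≥ N^(α/β).
exponent-drop : ∀ {m r α β c C N e} .{{_ : NonZero m}} .{{_ : NonZero N}} → α * m ≤ r * β → c ^ m ≤ C → C ≤ C ^ β →
  C * N ^ r ≤ e ^ m → c * N ^ α ≤ e ^ β
exponent-drop {m} {r} {α} {β} {c} {C} {N} {e} αm≤rβ cm≤C C≤Cβ le = ^-cancelˡ-≤ m (begin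
  (c * N ^ α) ^ m       ≡⟨ ^-distribʳ-* m c (N ^ α) ⟩
  c ^ m * (N ^ α) ^ m   ≡⟨ cong (c ^ m *_) (^-*-assoc N α m) ⟩
  c ^ m * N ^ (α * m)   ≤⟨ *-mono-≤ (≤-trans cm≤C C≤Cβ) (^-monoʳ-≤ N αm≤rβ) ⟩
  C ^ β * N ^ (r * β)   ≡⟨ cong (C ^ β *_) (^-*-assoc N r β) ⟨
  C ^ β * (N ^ r) ^ β   ≡⟨ ^-distribʳ-* β C (N ^ r) ⟨
  (C * N ^ r) ^ β       ≤⟨ ^-monoˡ-≤ β le ⟩
  (e ^ m) ^ β           ≡⟨ ^-comm e m β ⟩
  (e ^ β) ^ m           ∎)
  where open ≤-Reasoning

-- Passing to the subset divides `e` by at most `4 * P` but `N` by at least `P / 3`. The hypothesis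
-- on `P`, attainable since `r` will exceed `m`, says that the gain `(P / 3) ^ r` outweighs the loss
-- `(4 * P) ^ m`.
rescale : ∀ {m r P C N N′ e e′} .{{_ : NonZero P}} → (4 * P) ^ m * 3 ^ r ≤ P ^ r →
  e ≤ 4 * P * e′ → P * N′ ≤ 3 * N → e′ ^ m ≤ C * N′ ^ r → e ^ m ≤ C * N ^ r
rescale {m} {r} {P} {C} {N} {N′} {e} {e′} P-large e≤ N′≤ ih = *-cancelˡ-≤ (P ^ r) {{m^n≢0 P r}} (begin
  P ^ r * e ^ m                               ≤⟨ *-monoʳ-≤ (P ^ r) (^-monoˡ-≤ m e≤) ⟩
  P ^ r * (4 * P * e′) ^ m                    ≡⟨ cong (P ^ r *_) (^-distribʳ-* m (4 * P) e′) ⟩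
  P ^ r * ((4 * P) ^ m * e′ ^ m)              ≤⟨ *-monoʳ-≤ (P ^ r) (*-monoʳ-≤ ((4 * P) ^ m) ih) ⟩
  P ^ r * ((4 * P) ^ m * (C * N′ ^ r))        ≡⟨ regroup (P ^ r) ((4 * P) ^ m) C (N′ ^ r) ⟩
  (4 * P) ^ m * C * (P ^ r * N′ ^ r)          ≡⟨ cong ((4 * P) ^ m * C *_) (^-distribʳ-* r P N′) ⟨
  (4 * P) ^ m * C * (P * N′) ^ r              ≤⟨ *-monoʳ-≤ ((4 * P) ^ m * C) (^-monoˡ-≤ r N′≤) ⟩
  (4 * P) ^ m * C * (3 * N) ^ r               ≡⟨ cong ((4 * P) ^ m * C *_) (^-distribʳ-* r 3 N) ⟩
  (4 * P) ^ m * C * (3 ^ r * N ^ r)           ≡⟨ regroup′ ((4 * P) ^ m) C (3 ^ r) (N ^ r) ⟩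
  (4 * P) ^ m * 3 ^ r * (C * N ^ r)           ≤⟨ *-monoˡ-≤ (C * N ^ r) P-large ⟩
  P ^ r * (C * N ^ r)                         ∎)
  where
  open ≤-Reasoning
  regroup : ∀ p f C n → p * (f * (C * n)) ≡ f * C * (p * n)
  regroup = solve-∀
  regroup′ : ∀ f C t n → f * C * (t * n) ≡ f * t * (C * n)
  regroup′ = solve-∀

-- Regularisation and induction over subsets

edgesBetween-mono : (G : Graph n) {S S′ R R′ : Subset n} → S ⊑ S′ → R ⊑ R′ → edgesBetween G S R ≤ edgesBetween G S′ R′
edgesBetween-mono G {S} S⊑S′ R⊑R′ = ≤-trans (sumOn-mono S λ u _ → sumOn-⊑ R⊑R′) (sumOn-⊑ S⊑S′)

edgesBetween≤card² : (G : Graph n) (S : Subset n) → edgesBetween G S S ≤ card S * card S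
edgesBetween≤card² G S = ≤-trans (sumOn-mono S {g = const (card S)} λ u _ → sumOn-mono S λ v _ → 𝟙≤1 (adj G u v))
  (≤-reflexive (sumOn-const S (card S)))
  where
  𝟙≤1 : ∀ b → 𝟙 b ≤ 1
  𝟙≤1 true  = ≤-refl
  𝟙≤1 false = z≤n

module _ {n k t : ℕ} .{{_ : NonZero t}} (G : Graph n) (a b : Fin k → Fin t) (a≢b : ∀ v → a v ≢ b v)
  (parallel : ∀ v w → a v ≡ a w → b v ≡ b w → v ≡ w) (crossed : ∀ v w → a v ≡ b w → b v ≡ a w → v ≡ w)
  (noSub : ¬ Subdivision G a b) where

  private
    T : ℕ
    T = t + k

    instance
      T≢0 : NonZero T
      T≢0 = >-nonZero (≤-trans (>-nonZero⁻¹ t) (m≤m+n t k))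

  -- Absence of a subdivision excludes heavy cliques, and then the greedy choice starts from `A`.
  -- The extra factor `D` in the size hypothesis pays for `A` being only a `1 / D` proportion of
  -- `N`.
  not-almost-regular : (L A : Subset n) (N D δ : ℕ) .{{_ : NonZero N}} .{{_ : NonZero D}} → A ⊑ L → card L ≤ N →
    (∀ v → L v ≡ true → deg G L v ≤ D * δ) → (∀ v → A v ≡ true → δ ≤ deg G L v) → N ≤ D * card A →
    ¬ (∀ i → i ≤ t → shrink t T ^ t * threshold t T D * D * N ^ i ≤ δ * (δ * δ) ^ i)
  not-almost-regular L A N D δ A⊑L cardL max min cardA large =
    noSub (light⇒subdivision G L a b a≢b parallel crossed x system)
    where
    open ≤-Reasoning
    κ = shrink t T ^ t * threshold t T D
    noHeavy : ∀ (x : Fin t → Fin n) → ¬ (∀ i j → i <ᶠ j → x i ≢ x j × T ≤ codeg G L (x i) (x j))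
    noHeavy x heavy = noSub (heavy⇒subdivision G L a b a≢b x
      (λ i j i<j → proj₁ (heavy i j i<j)) (λ i j i<j → proj₂ (heavy i j i<j)))
    regroup : ∀ κ D c P → κ * (D * c) * P ≡ c * (κ * D * P)
    regroup = solve-∀
    regroup′ : ∀ c d P → c * (d * P) ≡ d * c * P
    regroup′ = solve-∀
    large′ : ∀ i → i ≤ t → κ * N * N ^ i ≤ δ * card A * (δ * δ) ^ i
    large′ i i≤t = begin
      κ * N * N ^ i                  ≤⟨ *-monoˡ-≤ (N ^ i) (*-monoʳ-≤ κ cardA) ⟩
      κ * (D * card A) * N ^ i       ≡⟨ regroup κ D (card A) (N ^ i) ⟩
      card A * (κ * D * N ^ i)       ≤⟨ *-monoʳ-≤ (card A) (large i i≤t) ⟩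
      card A * (δ * (δ * δ) ^ i)     ≡⟨ regroup′ (card A) δ ((δ * δ) ^ i) ⟩
      δ * card A * (δ * δ) ^ i       ∎
    open LightExtension (greedy-light G L T t N D δ cardL noHeavy max t [] A A⊑L min ≤-refl (λ _ _ ()) large′)

  module _ (P : ℕ) .{{_ : NonZero P}} (S : Subset n) where

    private
      N e : ℕ
      N = card S
      e = edgesBetween G S S

    -- `e / N` is the average degree inside `S`; the cutoff is `P` times the average.
    low : Subset n
    low v = deg G S v * N ≤ᵇ P * e

    -- Take `δ` about a quarter of the average degree. Vertices of `L` below `δ` account for at most
    -- `e / 4` of the at least `e / 2` inside `L`, so `A` carries `e / 4`. As degrees in `L` are at
    -- most `P * e / N`, this forces `|A| ≥ N / 4P`, and the same bound is at most `4 * P * δ`: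
    -- hence `D = 4 * P` in both roles.
    not-mostly-low : .{{_ : NonZero N}} .{{_ : NonZero e}} →
      e ≤ 2 * edgesBetween G (S ⩕ low) (S ⩕ low) →
      ¬ (∀ i → i ≤ t → shrink t T ^ t * threshold t T (4 * P) * (4 * P) * N ^ i * (4 * N * (4 * N * (4 * N)) ^ i) ≤ e * (e * e) ^ i)
    not-mostly-low half large = not-almost-regular L A N (4 * P) δ {{it}} {{m*n≢0 4 P}} (⩕-⊑ˡ L rich) (sumOn-⊑ (⩕-⊑ˡ S low)) max
      (λ v → ≤ᵇ-true⁻ ∘ proj₂ ∘ ∧-true⁻ {L v}) cardA large′
      where
      open ≤-Reasoning
      instance
        4N≢0 : NonZero (4 * N)
        4N≢0 = m*n≢0 4 N
      L : Subset n
      L = S ⩕ low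
      δ′ δ : ℕ
      δ′ = e / (4 * N)
      -- Rounding strictly up gives `e ≤ 4 * N * δ`, while a vertex that is not `rich` has degree at
      -- most `δ′`, hence at most `e / 4N`.
      δ = suc δ′
      rich A : Subset n
      rich v = δ ≤ᵇ deg G L v
      A = L ⩕ rich
      e≤ : e ≤ 4 * N * δ
      e≤ = begin
        e                                    ≡⟨ m≡m%n+[m/n]*n e (4 * N) ⟩
        e % (4 * N) + e / (4 * N) * (4 * N)  ≤⟨ +-monoˡ-≤ _ (<⇒≤ (m%n<n e (4 * N))) ⟩
        δ * (4 * N)                          ≡⟨ *-comm δ (4 * N) ⟩
        4 * N * δ                            ∎
      deg*N≤ : ∀ v → L v ≡ true → deg G L v * N ≤ P * e
      deg*N≤ v Lv = ≤-trans (*-monoˡ-≤ N (sumOn-⊑ (⩕-⊑ˡ S low))) (≤ᵇ-true⁻ (proj₂ (∧-true⁻ {S v} Lv)))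
      max : ∀ v → L v ≡ true → deg G L v ≤ 4 * P * δ
      max v Lv = *-cancelʳ-≤ _ _ N (begin
        deg G L v * N       ≤⟨ deg*N≤ v Lv ⟩
        P * e               ≤⟨ *-monoʳ-≤ P e≤ ⟩
        P * (4 * N * δ)     ≡⟨ regroup P N δ ⟩
        4 * P * δ * N       ∎)
        where
        regroup : ∀ P N d → P * (4 * N * d) ≡ 4 * P * d * N
        regroup = solve-∀
      outside : 4 * sumOn (L ∖ rich) (deg G L) ≤ e
      outside = begin
        4 * sumOn (L ∖ rich) (deg G L)   ≤⟨ *-monoʳ-≤ 4 (sumOn-mono (L ∖ rich) λ v Lv →
                                                                ≤-pred (≤ᵇ-false⁻ (not-true⁻ (proj₂ (∧-true⁻ {L v} Lv))))) ⟩
        4 * sumOn (L ∖ rich) (const δ′)  ≡⟨ cong (4 *_) (sumOn-const (L ∖ rich) δ′) ⟩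
        4 * (card (L ∖ rich) * δ′)       ≤⟨ *-monoʳ-≤ 4 (*-monoˡ-≤ δ′ (sumOn-⊑ λ v → ⩕-⊑ˡ S low v ∘ ∖-⊑ L rich v)) ⟩
        4 * (N * δ′)                                       ≡⟨ regroup N δ′ ⟩
        δ′ * (4 * N)                                       ≤⟨ m/n*n≤m e (4 * N) ⟩
        e                                                  ∎
        where
        regroup : ∀ N d → 4 * (N * d) ≡ d * (4 * N)
        regroup = solve-∀
      inside : e ≤ 4 * sumOn A (deg G L)
      inside = +-cancelʳ-≤ e _ _ (begin
        e + e                                        ≤⟨ +-mono-≤ half half ⟩
        2 * edgesBetween G L L + 2 * edgesBetween G L L ≡⟨ regroup (edgesBetween G L L) ⟩
        4 * edgesBetween G L L                       ≡⟨ cong (4 *_) (sumOn-split L rich (deg G L)) ⟩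
        4 * (sumOn A (deg G L) + sumOn (L ∖ rich) (deg G L)) ≡⟨ *-distribˡ-+ 4 (sumOn A (deg G L)) _ ⟩
        4 * sumOn A (deg G L) + 4 * sumOn (L ∖ rich) (deg G L) ≤⟨ +-monoʳ-≤ (4 * sumOn A (deg G L)) outside ⟩
        4 * sumOn A (deg G L) + e                    ∎)
        where
        regroup : ∀ x → 2 * x + 2 * x ≡ 4 * x
        regroup = solve-∀
      cardA : N ≤ 4 * P * card A
      cardA = *-cancelʳ-≤ _ _ e (begin
        N * e                                  ≤⟨ *-monoʳ-≤ N inside ⟩
        N * (4 * sumOn A (deg G L))            ≡⟨ regroup N (sumOn A (deg G L)) ⟩
        4 * (sumOn A (deg G L) * N)            ≡⟨ cong (4 *_) (sumOn-*ʳ A N (deg G L)) ⟨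
        4 * sumOn A (λ v → deg G L v * N)      ≤⟨ *-monoʳ-≤ 4 (sumOn-mono A λ v Av → deg*N≤ v (⩕-⊑ˡ L rich v Av)) ⟩
        4 * sumOn A (const (P * e))            ≡⟨ cong (4 *_) (sumOn-const A (P * e)) ⟩
        4 * (card A * (P * e))                 ≡⟨ regroup′ (card A) P e ⟩
        4 * P * card A * e                     ∎)
        where
        regroup : ∀ N s → N * (4 * s) ≡ 4 * (s * N)
        regroup = solve-∀
        regroup′ : ∀ c P e → 4 * (c * (P * e)) ≡ 4 * P * c * e
        regroup′ = solve-∀
      κ = shrink t T ^ t * threshold t T (4 * P) * (4 * P)
      large′ : ∀ i → i ≤ t → κ * N ^ i ≤ δ * (δ * δ) ^ i
      -- `M` is `(4N)^(2i+1)`: it clears the denominators when `e / 4N ≤ δ` is raised to the power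
      -- `2i + 1`.
      large′ i i≤t = *-cancelʳ-≤ _ _ M {{m*n≢0 (4 * N) _ {{it}} {{m^n≢0 (4 * N * (4 * N)) i {{m*n≢0 (4 * N) (4 * N)}}}}}} (begin
        κ * N ^ i * M                                     ≤⟨ large i i≤t ⟩
        e * (e * e) ^ i                                   ≤⟨ *-mono-≤ e≤ (^-monoˡ-≤ i (*-mono-≤ e≤ e≤)) ⟩
        4 * N * δ * (4 * N * δ * (4 * N * δ)) ^ i         ≡⟨ cong (λ x → 4 * N * δ * x ^ i) (regroup (4 * N) δ) ⟩
        4 * N * δ * (δ * δ * (4 * N * (4 * N))) ^ i       ≡⟨ cong (4 * N * δ *_) (^-distribʳ-* i (δ * δ) _) ⟩
        4 * N * δ * ((δ * δ) ^ i * (4 * N * (4 * N)) ^ i) ≡⟨ regroup′ (4 * N) δ ((δ * δ) ^ i) ((4 * N * (4 * N)) ^ i) ⟩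
        δ * (δ * δ) ^ i * M                               ∎)
        where
        M = 4 * N * (4 * N * (4 * N)) ^ i
        regroup : ∀ x d → x * d * (x * d) ≡ d * d * (x * x)
        regroup = solve-∀
        regroup′ : ∀ x d X Y → x * d * (X * Y) ≡ d * X * (x * Y)
        regroup′ = solve-∀

    -- If the high-degree vertices B meet half of the edges, then B together with the best of P parts
    -- of S carries a 1/4P fraction of the edges on only 3N/P vertices.
    densify : .{{_ : NonZero e}} → P ≤ N → 2 * edgesBetween G (S ⩕ low) (S ⩕ low) ≤ e →
      ∃ λ S′ → P * card S′ ≤ 3 * N × e ≤ 4 * P * edgesBetween G S′ S′
    densify P≤N half =
      let R , cardR , heavy = heavy-part S (deg G B) P m N≤Pm
      in B ⩖ R , size R cardR , count R heavy
      where
      open ≤-Reasoning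
      B L : Subset n
      B = S ∖ low
      L = S ⩕ low
      m : ℕ
      -- Large enough for `P` parts to cover `S`, yet `P * m ≤ 2N` because `P ≤ N`. Together with
      -- `P * card B ≤ N` this gives the `3 * N`.
      m = suc (N / P)
      N≤Pm : N ≤ P * m
      N≤Pm = begin
        N                      ≡⟨ m≡m%n+[m/n]*n N P ⟩
        N % P + N / P * P      ≤⟨ +-monoˡ-≤ _ (<⇒≤ (m%n<n N P)) ⟩
        m * P                  ≡⟨ *-comm m P ⟩
        P * m                  ∎
      Pm≤2N : P * m ≤ N + N
      Pm≤2N = begin
        P * m                  ≡⟨ *-comm P m ⟩
        P + N / P * P          ≤⟨ +-mono-≤ P≤N (m/n*n≤m N P) ⟩
        N + N                  ∎
      cardB : P * card B ≤ N
      cardB = *-cancelʳ-≤ _ _ e (begin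
        P * card B * e                 ≡⟨ regroup P (card B) e ⟩
        card B * (P * e)               ≡⟨ sumOn-const B (P * e) ⟨
        sumOn B (const (P * e))        ≤⟨ sumOn-mono B (λ v Bv → <⇒≤ (≤ᵇ-false⁻ (not-true⁻ (proj₂ (∧-true⁻ {S v} Bv))))) ⟩
        sumOn B (λ v → deg G S v * N)  ≡⟨ sumOn-*ʳ B N (deg G S) ⟩
        edgesBetween G B S * N         ≤⟨ *-monoˡ-≤ N (sumOn-⊑ (∖-⊑ S low)) ⟩
        e * N                          ≡⟨ *-comm e N ⟩
        N * e                          ∎)
        where
        regroup : ∀ P c e → P * c * e ≡ c * (P * e)
        regroup = solve-∀
      size : ∀ R → card R ≤ m → P * card (B ⩖ R) ≤ 3 * N
      size R cardR = begin
        P * card (B ⩖ R)         ≤⟨ *-monoʳ-≤ P (≤-trans (card-⩖ B R) (+-monoʳ-≤ (card B) cardR)) ⟩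
        P * (card B + m)         ≡⟨ *-distribˡ-+ P (card B) m ⟩
        P * card B + P * m       ≤⟨ +-mono-≤ cardB Pm≤2N ⟩
        N + (N + N)              ≡⟨ regroup N ⟩
        3 * N                    ∎
        where
        regroup : ∀ x → x + (x + x) ≡ 3 * x
        regroup = solve-∀
      e≤4BS : e ≤ 4 * edgesBetween G B S
      e≤4BS = +-cancelˡ-≤ e _ _ (begin
        e + e                                               ≡⟨ twice e ⟩
        2 * e                                               ≤⟨ *-monoʳ-≤ 2 split ⟩
        2 * (edgesBetween G L L + edgesBetween G B S + edgesBetween G B S) ≡⟨ regroup (edgesBetween G L L) (edgesBetween G B S) ⟩
        2 * edgesBetween G L L + 4 * edgesBetween G B S     ≤⟨ +-monoˡ-≤ _ half ⟩
        e + 4 * edgesBetween G B S                          ∎)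
        where
        twice : ∀ x → x + x ≡ 2 * x
        twice = solve-∀
        regroup : ∀ x y → 2 * (x + y + y) ≡ 2 * x + 4 * y
        regroup = solve-∀
        split : e ≤ edgesBetween G L L + edgesBetween G B S + edgesBetween G B S
        split = begin
          e                                                            ≡⟨ sumOn-split S low (deg G S) ⟩
          edgesBetween G L S + edgesBetween G B S                      ≡⟨ cong (_+ edgesBetween G B S) (edgesBetween-sym G L S) ⟩
          edgesBetween G S L + edgesBetween G B S                      ≡⟨ cong (_+ edgesBetween G B S) (sumOn-split S low (deg G L)) ⟩
          edgesBetween G L L + edgesBetween G B L + edgesBetween G B S ≤⟨ +-monoˡ-≤ (edgesBetween G B S) (+-monoʳ-≤ (edgesBetween G L L)
                                                                            (sumOn-mono B λ u _ → sumOn-⊑ (⩕-⊑ˡ S low))) ⟩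
          edgesBetween G L L + edgesBetween G B S + edgesBetween G B S ∎
      count : ∀ R → sumOn S (deg G B) ≤ P * sumOn R (deg G B) → e ≤ 4 * P * edgesBetween G (B ⩖ R) (B ⩖ R)
      count R heavy = begin
        e                                               ≤⟨ e≤4BS ⟩
        4 * edgesBetween G B S                          ≡⟨ cong (4 *_) (edgesBetween-sym G B S) ⟩
        4 * edgesBetween G S B                          ≤⟨ *-monoʳ-≤ 4 heavy ⟩
        4 * (P * edgesBetween G R B)                    ≡⟨ *-assoc 4 P _ ⟨
        4 * P * edgesBetween G R B                      ≤⟨ *-monoʳ-≤ (4 * P) (edgesBetween-mono G (⩖-⊑ʳ B R) (⩖-⊑ˡ B R)) ⟩
        4 * P * edgesBetween G (B ⩖ R) (B ⩖ R)          ∎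

  module _ (P m r C : ℕ) .{{_ : NonZero m}} (4≤P : 4 ≤ P)
    (P-large : (4 * P) ^ m * 3 ^ r ≤ P ^ r)
    (small : ∀ N → N ≤ P → (N * N) ^ m ≤ C * N ^ r)
    (drop : ∀ N e .{{_ : NonZero N}} → C * N ^ r ≤ e ^ m → ∀ i → i ≤ t →
      shrink t T ^ t * threshold t T (4 * P) * (4 * P) * N ^ i * (4 * N * (4 * N * (4 * N)) ^ i) ≤ e * (e * e) ^ i)
    where

    private instance
      P≢0 : NonZero P
      P≢0 = >-nonZero (≤-trans (s≤s z≤n) 4≤P)

    -- Strong induction on `card S`, bounded by `l`. Sets of at most `P` vertices and sets without
    -- edges are settled directly, and `4 ≤ P` makes the subset from `densify`, of size at most
    -- `3N / P`, strictly smaller.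
    density-bound : ∀ l S → card S ≤ l → edgesBetween G S S ^ m ≤ C * card S ^ r
    density-bound l S cardS≤l with ≤-total (card S) P | edgesBetween G S S in eq
    ... | inj₁ N≤P | e = ≤-trans (^-monoˡ-≤ m (subst (_≤ card S * card S) eq (edgesBetween≤card² G S))) (small (card S) N≤P)
    ... | inj₂ P≤N | zero = ≤-trans (≤-reflexive (0^m m)) z≤n
      where
      0^m : ∀ m .{{_ : NonZero m}} → 0 ^ m ≡ 0
      0^m (suc m) = refl
    ... | inj₂ P≤N | suc _ = subst (λ e → e ^ m ≤ C * card S ^ r) eq (by-cases l cardS≤l)
      where
      open ≤-Reasoning
      e = edgesBetween G S S
      N = card S
      instance
        e≢0 : NonZero e
        e≢0 = subst NonZero (≡-sym eq) _
        N≢0 : NonZero N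
        N≢0 = >-nonZero (≤-trans (>-nonZero⁻¹ P) P≤N)
      smaller : ∀ S′ → P * card S′ ≤ 3 * N → card S′ < N
      smaller S′ le = *-cancelˡ-< P (card S′) N (begin-strict
        P * card S′   ≤⟨ le ⟩
        3 * N         <⟨ *-monoˡ-< N {3} {4} (n<1+n 3) ⟩
        4 * N         ≤⟨ *-monoˡ-≤ N 4≤P ⟩
        P * N         ∎)
      by-cases : ∀ l → card S ≤ l → e ^ m ≤ C * N ^ r
      by-cases zero    N≤l = contradiction (≤-trans (>-nonZero⁻¹ N) N≤l) λ ()
      by-cases (suc l) N≤l with ≤-total e (2 * edgesBetween G (S ⩕ low P S) (S ⩕ low P S))
      -- A failure of the bound is the density from which `drop` produces the inequalities that
      -- `not-mostly-low` refutes.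
      ... | inj₁ half with ≤-total (e ^ m) (C * N ^ r)
      ...   | inj₁ done = done
      ...   | inj₂ dense = ⊥-elim (not-mostly-low P S half (drop N e dense))
      by-cases (suc l) N≤l | inj₂ half =
        let S′ , size , count = densify P S P≤N half
        in rescale {m} {r} {P} {C} {N} {card S′} P-large count size (density-bound l S′ (≤-pred (≤-trans (smaller S′ size) N≤l)))

-- Choice of the constants

edges≤edgesBetween : (G : Graph n) → edges G ≤ edgesBetween G (const true) (const true)
edges≤edgesBetween G = sumFin-mono λ i → sumFin-mono λ j → 𝟙-∧≤ (adj G i j) _
  where
  𝟙-∧≤ : ∀ p q → 𝟙 (p ∧ q) ≤ 𝟙 p
  𝟙-∧≤ true  true  = ≤-refl
  𝟙-∧≤ true  false = z≤n
  𝟙-∧≤ false _     = z≤n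

subdivision-free-bound : ∀ {k t} .{{_ : NonZero t}} (a b : Fin k → Fin t) → (∀ v → a v ≢ b v) →
  (∀ v w → a v ≡ a w → b v ≡ b w → v ≡ w) → (∀ v w → a v ≡ b w → b v ≡ a w → v ≡ w) →
  Σ ℕ λ C → 1 ≤ C × (∀ n (G : Graph n) → ¬ Subdivision G a b →
    edges G ^ (2 * (4 * t + 3)) * n ^ 2 ≤ C * n ^ (3 * (4 * t + 3)))
subdivision-free-bound {k} {t} a b a≢b parallel crossed = C , C≥1 , bound
  where
  open ≤-Reasoning
  m r P κ c C : ℕ
  -- `r = 3m/2 - 2`, so `r / m = 3/2 - 1/(4t+3)`.
  m = 2 * (4 * t + 3)
  r = 12 * t + 7
  -- With this `P`, `(4 * P) ^ m * 3 ^ r` equals `P ^ (m + 1)`, and `m < r`.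
  P = 4 ^ m * 3 ^ r
  κ = shrink t (t + k) ^ t * threshold t (t + k) (4 * P) * (4 * P)
  -- `4 * 16 ^ t` bounds the powers `4^(2i+1)` coming from `(4N)^(2i+1)`.
  c = κ * 4 * 16 ^ t
  -- The first summand handles `N ≤ P`, where `e ≤ N²` and `2m - r = 4t + 5`; the second makes
  -- `c ^ m ≤ C` for `drop`.
  C = P ^ (4 * t + 5) + c ^ m

  m≡ : ∀ t → 2 * (4 * t + 3) ≡ suc (8 * t + 5)
  m≡ = solve-∀
  r≡ : ∀ t → 12 * t + 7 ≡ suc (2 * (4 * t + 3)) + 4 * t
  r≡ = solve-∀

  instance
    m≢0 : NonZero m
    m≢0 = subst NonZero (≡-sym (m≡ t)) _
    P≢0 : NonZero P
    P≢0 = m*n≢0 (4 ^ m) (3 ^ r) {{m^n≢0 4 m}} {{m^n≢0 3 r}}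

  4≤P : 4 ≤ P
  4≤P = ≤-trans (≤-reflexive (≡-sym (^-identityʳ 4))) (≤-trans (^-monoʳ-≤ 4 (>-nonZero⁻¹ m)) (m≤m*n (4 ^ m) (3 ^ r) {{m^n≢0 3 r}}))

  P-large : (4 * P) ^ m * 3 ^ r ≤ P ^ r
  P-large = begin
    (4 * P) ^ m * 3 ^ r       ≡⟨ cong (_* 3 ^ r) (^-distribʳ-* m 4 P) ⟩
    4 ^ m * P ^ m * 3 ^ r     ≡⟨ regroup (4 ^ m) (P ^ m) (3 ^ r) ⟩
    P ^ suc m                 ≤⟨ ^-monoʳ-≤ P (≤-trans (m≤m+n (suc m) (4 * t)) (≤-reflexive (≡-sym (r≡ t)))) ⟩
    P ^ r                     ∎
    where
    regroup : ∀ x y z → x * y * z ≡ x * z * y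
    regroup = solve-∀

  C≥1 : 1 ≤ C
  C≥1 = ≤-trans (m^n>0 P (4 * t + 5)) (m≤m+n _ _)

  instance
    C≢0 : NonZero C
    C≢0 = >-nonZero C≥1

  small : ∀ N → N ≤ P → (N * N) ^ m ≤ C * N ^ r
  small N N≤P = begin
    (N * N) ^ m                   ≡⟨ ^-distribʳ-* m N N ⟩
    N ^ m * N ^ m                 ≡⟨ ^-distribˡ-+-* N m m ⟨
    N ^ (m + m)                   ≡⟨ cong (N ^_) (exponent t) ⟩
    N ^ ((4 * t + 5) + r)         ≡⟨ ^-distribˡ-+-* N (4 * t + 5) r ⟩
    N ^ (4 * t + 5) * N ^ r       ≤⟨ *-monoˡ-≤ (N ^ r) (≤-trans (^-monoˡ-≤ (4 * t + 5) N≤P) (m≤m+n _ _)) ⟩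
    C * N ^ r                     ∎
    where
    exponent : ∀ t → 2 * (4 * t + 3) + 2 * (4 * t + 3) ≡ (4 * t + 5) + (12 * t + 7)
    exponent = solve-∀

  drop : ∀ N e .{{_ : NonZero N}} → C * N ^ r ≤ e ^ m → ∀ i → i ≤ t →
    κ * N ^ i * (4 * N * (4 * N * (4 * N)) ^ i) ≤ e * (e * e) ^ i
  drop N e dense i i≤t = begin
    κ * N ^ i * (4 * N * (4 * N * (4 * N)) ^ i)             ≡⟨ cong (λ x → κ * N ^ i * (4 * N * x ^ i)) (square N) ⟩
    κ * N ^ i * (4 * N * (16 * (N * N)) ^ i)                ≡⟨ cong (λ x → κ * N ^ i * (4 * N * x)) (trans (^-distribʳ-* i 16 (N * N)) (cong (16 ^ i *_) (^-distribʳ-* i N N))) ⟩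
    κ * N ^ i * (4 * N * (16 ^ i * (N ^ i * N ^ i)))        ≡⟨ regroup κ (N ^ i) N (16 ^ i) ⟩
    κ * 4 * 16 ^ i * (N * (N ^ i * (N ^ i * N ^ i)))        ≡⟨ cong (λ x → κ * 4 * 16 ^ i * (N * x)) (trans (^-distribˡ-+-* N i (i + i)) (cong (N ^ i *_) (^-distribˡ-+-* N i i))) ⟨
    κ * 4 * 16 ^ i * N ^ suc (i + (i + i))                  ≤⟨ *-monoˡ-≤ (N ^ suc (i + (i + i))) (*-monoʳ-≤ (κ * 4) (^-monoʳ-≤ 16 i≤t)) ⟩
    c * N ^ suc (i + (i + i))                               ≤⟨ exponent-drop {m} {r} {suc (i + (i + i))} {suc (i + i)} {c} {C} {N} {e} exponents (m≤n+m (c ^ m) _) C≤ dense ⟩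
    e ^ suc (i + i)                                         ≡⟨ cong (e *_) (trans (^-distribˡ-+-* e i i) (≡-sym (^-distribʳ-* i e e))) ⟩
    e * (e * e) ^ i                                         ∎
    where
    square : ∀ N → 4 * N * (4 * N) ≡ 16 * (N * N)
    square = solve-∀
    regroup : ∀ κ X N S → κ * X * (4 * N * (S * (X * X))) ≡ κ * 4 * S * (N * (X * (X * X)))
    regroup = solve-∀
    C≤ : C ≤ C ^ suc (i + i)
    C≤ = m≤m*n C (C ^ (i + i)) {{m^n≢0 C (i + i)}}
    -- Here `o` is `t - i`, and the slack `4 * o + 1` shows that the demand is tightest at the last
    -- step `i = t`.
    identity : ∀ i o → suc (i + (i + i)) * (2 * (4 * (i + o) + 3)) + (4 * o + 1) ≡ (12 * (i + o) + 7) * suc (i + i)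
    identity = solve-∀
    exponents : suc (i + (i + i)) * m ≤ r * suc (i + i)
    exponents with o , i+o≡t ← m≤n⇒∃[o]m+o≡n i≤t =
      subst (λ t → suc (i + (i + i)) * (2 * (4 * t + 3)) ≤ (12 * t + 7) * suc (i + i)) i+o≡t
        (≤-trans (m≤m+n _ (4 * o + 1)) (≤-reflexive (identity i o)))

  bound : ∀ n (G : Graph n) → ¬ Subdivision G a b → edges G ^ m * n ^ 2 ≤ C * n ^ (3 * (4 * t + 3))
  bound n G noSub = begin
    edges G ^ m * n ^ 2                                     ≤⟨ *-monoˡ-≤ (n ^ 2) (^-monoˡ-≤ m (edges≤edgesBetween G)) ⟩
    edgesBetween G (const true) (const true) ^ m * n ^ 2    ≤⟨ *-monoˡ-≤ (n ^ 2) (density-bound G a b a≢b parallel crossed noSub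
                                                                 P m r C 4≤P P-large small drop n (const true) (≤-reflexive (sumFin-1 {n}))) ⟩
    C * card {n} (const true) ^ r * n ^ 2                   ≡⟨ cong (λ x → C * x ^ r * n ^ 2) (sumFin-1 {n}) ⟩
    C * n ^ r * n ^ 2                                       ≡⟨ *-assoc C (n ^ r) (n ^ 2) ⟩
    C * (n ^ r * n ^ 2)                                     ≡⟨ cong (C *_) (^-distribˡ-+-* n r 2) ⟨
    C * n ^ (r + 2)                                         ≡⟨ cong (λ x → C * n ^ x) (exponent t) ⟩
    C * n ^ (3 * (4 * t + 3))                               ∎
    where
    exponent : ∀ t → 12 * t + 7 + 2 ≡ 3 * (4 * t + 3)
    exponent = solve-∀

-- Encoding `H` by pairs of slots

-- The slots are three copies of the vertices of H: copy 0 hosts X, and copies 1 and 2 supply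
-- private partners for the vertices with fewer than two neighbours.
opaque
  slot : Fin 3 → Fin k → Fin (suc (3 * k))
  -- The shift goes with `3k + 1` slots, a nonzero number even for `k = 0`.
  slot i v = suc (combine i v)

  slot-injective : ∀ {i j} {v w : Fin k} → slot i v ≡ slot j w → i ≡ j × v ≡ w
  slot-injective {i = i} {j} {v} {w} eq = F.combine-injective i v j w (F.suc-injective eq)

slot₁ slot₂ : Fin k → List (Fin k) → Fin (suc (3 * k))
slot₁ v []      = slot (suc zero) v
slot₁ v (x ∷ _) = slot zero x
slot₂ v []          = slot (suc (suc zero)) v
slot₂ v (_ ∷ [])    = slot (suc zero) v
slot₂ v (_ ∷ y ∷ _) = slot zero y

nbrs : Graph k → Fin k → List (Fin k)
nbrs H v = filter (λ w → adj H v w B.≟ true) (allFin _)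

∈-nbrs⁻ : (H : Graph k) {v w : Fin k} → w ∈ nbrs H v → adj H v w ≡ true
∈-nbrs⁻ H {v} = proj₂ ∘ ∈-filter⁻ (λ w → adj H v w B.≟ true) {xs = allFin _}

∈-nbrs⁺ : (H : Graph k) {v w : Fin k} → adj H v w ≡ true → w ∈ nbrs H v
∈-nbrs⁺ H {v} {w} = ∈-filter⁺ (λ w → adj H v w B.≟ true) (∈-allFin w)

nbrs-unique : (H : Graph k) (v : Fin k) → Unique (nbrs H v)
nbrs-unique H v = Uniq.filter⁺ (λ w → adj H v w B.≟ true) (Uniq.allFin⁺ _)

length-nbrs : (H : Graph k) (v : Fin k) → length (nbrs H v) ≡ degree H v
length-nbrs {k} H v = counted id
  where
  counted : ∀ {l} (f : Fin l → Fin k) →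
    length (filter (λ w → adj H v w B.≟ true) (tabulate f)) ≡ sumFin (λ i → 𝟙 (adj H v (f i)))
  counted {zero}  f = refl
  counted {suc l} f with adj H v (f zero)
  ... | true  = cong suc (counted (f ∘ suc))
  ... | false = counted (f ∘ suc)

unique-second : ∀ {A : Set} {x y : A} {xs} → Unique (x ∷ y ∷ xs) → x ≢ y
unique-second ((x≢y ∷ᵃ _) ∷ᵖ _) = x≢y

two-common-nbrs⇒C4 : (H : Graph k) {v w x y : Fin k} → v ≢ w → x ≢ y → adj H v x ≡ true → adj H v y ≡ true →
  adj H w x ≡ true → adj H w y ≡ true → Contains H C4
two-common-nbrs⇒C4 {k} H {v} {w} {x} {y} v≢w x≢y vx vy wx wy = f , f-inj , f-hom
  where
  f : Fin 4 → Fin k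
  f zero                   = x
  f (suc zero)             = v
  f (suc (suc zero))       = y
  f (suc (suc (suc zero))) = w
  adj⇒≢ : ∀ {p q} → adj H p q ≡ true → p ≢ q
  adj⇒≢ {p} pq refl = true≢false pq (irrefl H p)
  flip : ∀ {p q} → adj H p q ≡ true → adj H q p ≡ true
  flip {p} {q} = trans (sym H q p)
  f-inj : Injective _≡_ _≡_ f
  f-inj {zero} {zero} _ = refl
  f-inj {zero} {suc zero} eq = contradiction (≡-sym eq) (adj⇒≢ vx)
  f-inj {zero} {suc (suc zero)} eq = contradiction eq x≢y
  f-inj {zero} {suc (suc (suc zero))} eq = contradiction (≡-sym eq) (adj⇒≢ wx)
  f-inj {suc zero} {zero} eq = contradiction eq (adj⇒≢ vx)
  f-inj {suc zero} {suc zero} _ = refl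
  f-inj {suc zero} {suc (suc zero)} eq = contradiction eq (adj⇒≢ vy)
  f-inj {suc zero} {suc (suc (suc zero))} eq = contradiction eq v≢w
  f-inj {suc (suc zero)} {zero} eq = contradiction (≡-sym eq) x≢y
  f-inj {suc (suc zero)} {suc zero} eq = contradiction (≡-sym eq) (adj⇒≢ vy)
  f-inj {suc (suc zero)} {suc (suc zero)} _ = refl
  f-inj {suc (suc zero)} {suc (suc (suc zero))} eq = contradiction (≡-sym eq) (adj⇒≢ wy)
  f-inj {suc (suc (suc zero))} {zero} eq = contradiction eq (adj⇒≢ wx)
  f-inj {suc (suc (suc zero))} {suc zero} eq = contradiction (≡-sym eq) v≢w
  f-inj {suc (suc (suc zero))} {suc (suc zero)} eq = contradiction eq (adj⇒≢ wy)
  f-inj {suc (suc (suc zero))} {suc (suc (suc zero))} _ = refl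
  f-hom : ∀ i j → adj C4 i j ≡ true → adj H (f i) (f j) ≡ true
  f-hom zero (suc zero) _ = flip vx
  f-hom zero (suc (suc (suc zero))) _ = flip wx
  f-hom (suc zero) zero _ = vx
  f-hom (suc zero) (suc (suc zero)) _ = vy
  f-hom (suc zero) (suc (suc (suc zero))) ()
  f-hom (suc (suc zero)) (suc zero) _ = flip vy
  f-hom (suc (suc zero)) (suc (suc (suc zero))) _ = flip wy
  f-hom (suc (suc (suc zero))) zero _ = wx
  f-hom (suc (suc (suc zero))) (suc (suc zero)) _ = wy
  f-hom (suc (suc (suc zero))) (suc (suc (suc zero))) ()

module _ {k : ℕ} (H : Graph k) where

  -- Every vertex receives a pair, whatever its colour, so distinctness of the pairs rests on
  -- C₄-freeness alone. Colours and the degree bound enter with the embedding: for `v` of degree at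
  -- most 2 the two ends cover all neighbours.
  end₁ end₂ : Fin k → Fin (suc (3 * k))
  end₁ v = slot₁ v (nbrs H v)
  end₂ v = slot₂ v (nbrs H v)

  ends-distinct : ∀ v → end₁ v ≢ end₂ v
  ends-distinct v eq with nbrs H v | nbrs-unique H v
  ... | []        | _  = contradiction (proj₁ (slot-injective eq)) λ ()
  ... | _ ∷ []    | _  = contradiction (proj₁ (slot-injective eq)) λ ()
  ... | _ ∷ _ ∷ _ | un = unique-second un (proj₂ (slot-injective eq))

  module _ (noC4 : ¬ Contains H C4) where

    common-nbrs : ∀ {v w x y} → x ≢ y → x ∈ nbrs H v → y ∈ nbrs H v → x ∈ nbrs H w → y ∈ nbrs H w → v ≡ w
    common-nbrs {v} {w} x≢y vx vy wx wy with v F.≟ w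
    ... | yes v≡w = v≡w
    ... | no  v≢w = contradiction
      (two-common-nbrs⇒C4 H v≢w x≢y (∈-nbrs⁻ H vx) (∈-nbrs⁻ H vy) (∈-nbrs⁻ H wx) (∈-nbrs⁻ H wy)) noC4

    -- Equal pairs either share a private slot, which names its vertex, or come from two distinct
    -- common neighbours, which would close a C₄.
    ends-parallel : ∀ v w → end₁ v ≡ end₁ w → end₂ v ≡ end₂ w → v ≡ w
    ends-parallel v w eq₁ eq₂ with nbrs H v | nbrs H w | nbrs-unique H v | common-nbrs {v} {w}
    ... | []         | []         | _  | _ = proj₂ (slot-injective eq₁)
    ... | []         | _ ∷ _      | _  | _ = contradiction (proj₁ (slot-injective eq₁)) λ ()
    ... | _ ∷ _      | []         | _  | _ = contradiction (proj₁ (slot-injective eq₁)) λ ()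
    ... | _ ∷ []     | _ ∷ []     | _  | _ = proj₂ (slot-injective eq₂)
    ... | _ ∷ []     | _ ∷ _ ∷ _  | _  | _ = contradiction (proj₁ (slot-injective eq₂)) λ ()
    ... | _ ∷ _ ∷ _  | _ ∷ []     | _  | _ = contradiction (proj₁ (slot-injective eq₂)) λ ()
    ... | _ ∷ _ ∷ _  | _ ∷ _ ∷ _  | un | common =
      common (unique-second un) (here refl) (there (here refl))
        (here (proj₂ (slot-injective eq₁))) (there (here (proj₂ (slot-injective eq₂))))

    ends-crossed : ∀ v w → end₁ v ≡ end₂ w → end₂ v ≡ end₁ w → v ≡ w
    ends-crossed v w eq₁ eq₂ with nbrs H v | nbrs H w | nbrs-unique H v | common-nbrs {v} {w}
    ... | []         | []         | _  | _ = contradiction (proj₁ (slot-injective eq₁)) λ ()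
    -- Copy 1 is the first slot of an isolated vertex and the second slot of a leaf, so here it is
    -- the label that identifies `v` with `w`.
    ... | []         | _ ∷ []     | _  | _ = proj₂ (slot-injective eq₁)
    ... | []         | _ ∷ _ ∷ _  | _  | _ = contradiction (proj₁ (slot-injective eq₁)) λ ()
    ... | _ ∷ _      | []         | _  | _ = contradiction (proj₁ (slot-injective eq₁)) λ ()
    ... | _ ∷ _      | _ ∷ []     | _  | _ = contradiction (proj₁ (slot-injective eq₁)) λ ()
    ... | _ ∷ []     | _ ∷ _ ∷ _  | _  | _ = contradiction (proj₁ (slot-injective eq₂)) λ ()
    ... | _ ∷ _ ∷ _  | _ ∷ _ ∷ _  | un | common =
      common (unique-second un) (here refl) (there (here refl))
        (there (here (proj₂ (slot-injective eq₁)))) (here (proj₂ (slot-injective eq₂)))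

  nbr-is-end : ∀ {v w} → degree H v ≤ 2 → adj H v w ≡ true → slot zero w ≡ end₁ v ⊎ slot zero w ≡ end₂ v
  nbr-is-end {v} {w} deg≤2 vw with nbrs H v | length-nbrs H v | ∈-nbrs⁺ H {v} vw
  ... | _ ∷ _         | _   | here refl                 = inj₁ refl
  ... | _ ∷ _ ∷ _     | _   | there (here refl)         = inj₂ refl
  ... | _ ∷ _ ∷ _ ∷ _ | len | there (there _)           =
    contradiction (≤-trans (≤-reflexive len) deg≤2) λ { (s≤s (s≤s ())) }

  subdivision⇒contains : ∀ (c : Fin k → Bool) → IsBipartition H c → (∀ v → c v ≡ false → degree H v ≤ 2) →
    (G : Graph n) → Subdivision G end₁ end₂ → Contains G H
  subdivision⇒contains {n} c bip deg≤2 G sub = g , g-inj , g-hom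
    where
    open Subdivision sub
    g : Fin k → Fin n
    g v = if c v then x (slot zero v) else f v
    g-inj : Injective _≡_ _≡_ g
    g-inj {v} {w} eq with c v | c w
    ... | true  | true  = proj₂ (slot-injective (x-inj eq))
    ... | true  | false = contradiction (≡-sym eq) (f≢x w (slot zero v))
    ... | false | true  = contradiction eq (f≢x v (slot zero w))
    ... | false | false = f-inj eq
    f~x : ∀ {v w} → c v ≡ false → adj H v w ≡ true → adj G (f v) (x (slot zero w)) ≡ true
    f~x {v} {w} cv vw with nbr-is-end (deg≤2 v cv) vw
    ... | inj₁ eq = trans (cong (λ s → adj G (f v) (x s)) eq) (f~a v)
    ... | inj₂ eq = trans (cong (λ s → adj G (f v) (x s)) eq) (f~b v)
    g-hom : ∀ v w → adj H v w ≡ true → adj G (g v) (g w) ≡ true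
    g-hom v w vw with bip v w vw
    ... | inj₁ (cv , cw) rewrite cv | cw = trans (sym G _ _) (f~x cw (trans (sym H w v) vw))
    ... | inj₂ (cv , cw) rewrite cv | cw = f~x cv vw

theorem1p3 : ∀ {k} (H : Graph k) (c : Fin k → Bool) →
    IsBipartition H c →
    (∀ v → c v ≡ false → degree H v ≤ 2) →
    ¬ Contains H C4 →
    Σ ℕ λ C → Σ ℕ λ p → Σ ℕ λ q →
    (1 ≤ C) × (1 ≤ p) × (1 ≤ q) ×
    (∀ n (G : Graph n) → ¬ Contains G H →
    edges G ^ (2 * q) * n ^ (2 * p) ≤ C * n ^ (3 * q))
theorem1p3 {k} H c bip deg≤2 noC4 =
  let C , C≥1 , bound = subdivision-free-bound (end₁ H) (end₂ H) (ends-distinct H) (ends-parallel H noC4) (ends-crossed H noC4)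
  -- The saving is `p / q = 1 / (4t + 3)` for `t = 3k + 1` slots.
  in C , 1 , 4 * suc (3 * k) + 3 , C≥1 , ≤-refl , ≤-trans (s≤s z≤n) (m≤n+m 3 (4 * suc (3 * k))) ,
     λ n G noH → bound n G (noH ∘ subdivision⇒contains H c bip deg≤2 G)
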